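{- Let $k \geq 2$ be an integer and let $G=(V,E)$ be a $k$-connected graph with $n \geq 3$ vertices, $e$ edges, minimum degree $\delta$ and maximum degree $\Delta$. If any one of the following five conditions holds, then $G$ is Hamiltonian: [1] $$Z_1(G) \geq (n - k - 1)\Delta^2 + \frac{e^2}{2(k + 1)} + \frac{(k + 1) \Delta^3}{2 \delta};$$ [2] $$F(G) \leq (n - k - 1) \delta^3 + \frac{\delta (2 (k + 1)^2 \delta^2 - e^2)}{k + 1};$$ [3] $$F(G) \leq (n - k - 1) \delta^3 + \frac{\delta}{k + 1} \left( 2 (k + 1) \left((k + 1) \delta^2 + \frac{e^2}{n - k - 1}\right) - e^2 - 2 (k + 1) (n - k - 1) \Delta^2\right);$$ [4] $$Inv(G) \leq \frac{n - k - 1}{\Delta} + \frac{2 (k + 1)^2 \delta^2 - e^2}{(k + 1) \Delta^3};$$ [5] $$Inv(G) \leq \frac{n - k - 1}{\Delta} + \frac{1}{(k + 1) \Delta^3} \left( 2 (k + 1) \left((k + 1) \delta^2 + \frac{e^2}{n - k - 1}\right) - e^2 - 2 (k + 1) (n - k - 1) \Delta^2\right).$$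
   Context: Graphs are finite, undirected, without loops or multiple edges. $d(u)$ denotes the degree of vertex $u$; $\delta$ and $\Delta$ are the minimum and maximum degrees. The first Zagreb index is $Z_1(G)=\sum_{u\in V} d(u)^2$, the forgotten topological index is $F(G)=\sum_{u\in V} d(u)^3$, and the inverse degree is $Inv(G)=\sum_{u\in V}\frac{1}{d(u)}$. A graph is Hamiltonian if it has a cycle containing all its vertices. -}

module Defs where

open import Level using (0ℓ)
open import Data.Nat using (ℕ; _≤_; _<_; _^_)
open import Data.Integer using (+_)
open import Data.Rational using (ℚ; 0ℚ; 1ℚ; ≢-nonZero)
import Data.Rational as ℚ
import Data.Rational.Properties as ℚₚ
open import Data.Fin using (Fin)
import Data.Fin as Fin
open import Data.Fin.Subset using (Subset; ∣_∣; _∉_)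
open import Data.List using (List; _∷_; _∷ʳ_; length; filter; map; foldr; sum; allFin; cartesianProduct)
open import Data.List.Membership.Propositional using (_∈_)
open import Data.List.Relation.Unary.Linked using (Linked)
open import Data.List.Relation.Unary.Unique.Propositional using (Unique)
open import Data.Product using (_×_; _,_; ∃-syntax)
open import Relation.Binary using (Rel; Symmetric; Irreflexive; Decidable)
open import Relation.Binary.Construct.Closure.ReflexiveTransitive using (Star)
open import Relation.Binary.PropositionalEquality using (_≡_)
open import Relation.Nullary using (yes; no)
open import Relation.Nullary.Decidable using (_×-dec_)

record Graph (n : ℕ) : Set₁ where
  infix 4 _~_ _~?_
  field
    _~_    : Rel (Fin n) 0ℓ
    _~?_   : Decidable _~_
    sym    : Symmetric _~_
    irrefl : Irreflexive _≡_ _~_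

ι : ℕ → ℚ
ι m = (+ m) ℚ./ 1

-- Total division with the convention p ÷₀ 0 = 0.
infixl 7 _÷₀_
_÷₀_ : ℚ → ℚ → ℚ
p ÷₀ q with q ℚₚ.≟ 0ℚ
... | yes _   = 0ℚ
... | no q≢0 = ℚ._÷_ p q {{≢-nonZero q≢0}}

module _ {n : ℕ} (G : Graph n) where
  open Graph G

  degree : Fin n → ℕ
  degree u = length (filter (u ~?_) (allFin n))

  -- Each edge is listed once, as the pair of its endpoints in increasing order.
  edges : List (Fin n × Fin n)
  edges = filter (λ (u , v) → (u Fin.<? v) ×-dec (u ~? v))
                 (cartesianProduct (allFin n) (allFin n))

  edgeCount : ℕ
  edgeCount = length edges

  IsMinDegree : ℕ → Set
  IsMinDegree δ = (∃[ u ] degree u ≡ δ) × (∀ u → δ ≤ degree u)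

  IsMaxDegree : ℕ → Set
  IsMaxDegree Δ = (∃[ u ] degree u ≡ Δ) × (∀ u → degree u ≤ Δ)

  Z₁ : ℕ
  Z₁ = sum (map (λ u → degree u ^ 2) (allFin n))

  F : ℕ
  F = sum (map (λ u → degree u ^ 3) (allFin n))

  -- An isolated vertex contributes 0, by the convention for _÷₀_.
  Inv : ℚ
  Inv = foldr ℚ._+_ 0ℚ (map (λ u → 1ℚ ÷₀ ι (degree u)) (allFin n))

  -- Adjacency in the graph G − X.
  AdjAvoiding : Subset n → Rel (Fin n) 0ℓ
  AdjAvoiding X u v = u ∉ X × v ∉ X × u ~ v

  ConnectedAvoiding : Subset n → Set
  ConnectedAvoiding X = ∀ u v → u ∉ X → v ∉ X → Star (AdjAvoiding X) u v

  -- More than k vertices, and no deletion of fewer than k vertices disconnects G;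
  -- in particular the complete graph on k + 1 vertices is k-connected.
  IsConnected[_] : ℕ → Set
  IsConnected[ k ] = k < n × (∀ (X : Subset n) → ∣ X ∣ < k → ConnectedAvoiding X)

  -- The closed walk v, vs, v is a cycle on the vertices v ∷ vs.
  record IsCycle (v : Fin n) (vs : List (Fin n)) : Set where
    field
      length≥3 : 3 ≤ length (v ∷ vs)
      distinct : Unique (v ∷ vs)
      adjacent : Linked _~_ (v ∷ (vs ∷ʳ v))

  Hamiltonian : Set
  Hamiltonian = ∃[ v ] ∃[ vs ] (IsCycle v vs × (∀ u → u ∈ v ∷ vs))

{-# OPTIONS --safe #-}

-- Chvátal–Erdős: in a longest cycle C missing a vertex x₀, at least k vertices of C
-- are joined to the component of G − C containing x₀, and x₀ together with their
-- successors on C is independent.  Hence either G is Hamiltonian or it has an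
-- independent set I of size K = k + 1.  In the second case K δ ≤ Σ_I d ≤ e ≤ Σ_{V∖I} d,
-- and bounding the degree sums over I and V∖I separately turns each of the five
-- conditions into an equality: G is δ-regular with e = K δ.  Then V∖I is independent
-- of size K too, so G is K_{K,K} or, since δ ≥ k, K_{K,K} minus a perfect matching,
-- and an explicit zigzag is a Hamiltonian cycle.
module Submission where

open import Defs
open import Data.Nat using (ℕ)
import Data.Nat as ℕ
open import Data.Rational using (1ℚ; _+_; _-_; _*_; _≤_; _≥_; +-*-rawSemiring)
open import Algebra.Definitions.RawSemiring +-*-rawSemiring using (_^_)
open import Data.Sum using (_⊎_)

open import Data.Nat.ListAction using (sum)
open import Data.Nat.ListAction.Properties using (sum-++; sum-↭)
import Data.Nat.Properties as ℕₚ
open import Algebra.Properties.CommutativeSemigroup ℕₚ.+-commutativeSemigroup using (interchange)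
open import Data.Bool using (if_then_else_)
open import Data.Fin as Fin using (Fin)
import Data.Fin.Properties as Finₚ
open import Data.Fin.Subset as Subset using (Subset; ∣_∣; ⁅_⁆; inside; outside)
import Data.Fin.Subset.Properties as Subsetₚ
import Data.Vec as Vec
open import Data.List as List using (List; []; _∷_; _++_; _∷ʳ_; length; map; filter; reverse; take; allFin; cartesianProduct)
import Data.List.Properties as Listₚ
open import Data.List.Membership.Propositional using (_∈_; _∉_; find; lose)
open import Data.List.Membership.Propositional.Properties using (∈-allFin; ∈-∃++; ∈-filter⁺; ∈-filter⁻; ∈-map⁺; ∈-map⁻)
open import Data.List.Relation.Binary.Permutation.Propositional using (_↭_; ↭-refl; ↭-sym; ↭-trans; ↭-prep; ↭-swap; ↭-reflexive; module PermutationReasoning; ↭⇒↭ₛ)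
open import Data.List.Relation.Binary.Permutation.Propositional.Properties using (∈-resp-↭; All-resp-↭; ↭-length; ↭-reverse; ++-comm; ++⁺ʳ; ++⁺ˡ; map⁺; shift)
import Data.List.Relation.Binary.Permutation.Setoid.Properties as Permutationₛ
open import Data.List.Relation.Unary.All as All using (All; []; _∷_)
import Data.List.Relation.Unary.All.Properties as Allₚ
open import Data.List.Relation.Unary.AllPairs as AllPairs using (AllPairs; []; _∷_)
import Data.List.Relation.Unary.AllPairs.Properties as AllPairsₚ
open import Data.List.Relation.Unary.Any as Any using (Any; here; there)
open import Data.List.Relation.Unary.Linked using (Linked; [-]; _∷_)
open import Data.List.Relation.Unary.Unique.Propositional using (Unique)
import Data.List.Relation.Unary.Unique.Propositional.Properties as Uniqueₚ
open import Data.Product using (∃-syntax; _×_; _,_; proj₁; proj₂)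
open import Function using (_∘_; id)
open import Level using (Level)
open import Relation.Binary using (Rel; tri<; tri≈; tri>)
open import Relation.Binary.Construct.Closure.ReflexiveTransitive using (Star; ε; _◅_)
open import Relation.Binary.PropositionalEquality using (_≡_; _≢_; refl; sym; trans; cong; cong₂; subst; subst₂; setoid; module ≡-Reasoning)
open import Relation.Nullary using (¬_; yes; no; contradiction; Dec; does; ¬?)
open import Relation.Nullary.Decidable using (_×-dec_; decidable-stable; dec-true; dec-false)
open import Relation.Unary using (Pred)
open import Data.Nat using (zero; suc; z≤n; s≤s)
open import Data.Sum using (inj₁; inj₂; [_,_]′)
open import Data.Empty using (⊥; ⊥-elim)
import Data.Integer as ℤ
import Data.Integer.Properties as ℤₚ
open import Data.Rational as ℚ using (ℚ; 0ℚ)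
import Data.Rational.Properties as ℚₚ
import Data.Rational.Unnormalised as ℚᵘ
import Data.Rational.Unnormalised.Properties as ℚᵘₚ
open import Data.Rational.Solver using (module +-*-Solver)
open +-*-Solver using (solve; _:=_; _:+_; _:*_; _:-_; con)
open import Data.Nat.Tactic.RingSolver using (solve-∀)

-- No longest cycle is ever chosen. Any cycle that misses a vertex is turned into a longer cycle or
-- into the independent set, and since lengths are bounded by n the process stops. It can start from
-- a single edge, traversed back and forth. Write J for the complement of I and m = n - K for its
-- size. In the first condition one factor of each square over I is kept, so that the sum of d over
-- I survives; what remains is AM-GM in reverse for e and KΔ. In the second and fourth, F ≥ nδ³ and
-- Δ·Inv ≥ n leave exactly the room that 2(Kδ)² - e² cannot exceed, because e ≥ Kδ. The third and
-- fifth reduce to the second and fourth: e is at most the degree sum over J, hence at most mΔ, so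
-- e²/m never outweighs mΔ². The hypothesis k ≥ 2 gives K ≥ 3, which the perfect matching case
-- needs: K_{2,2} minus a perfect matching is two disjoint edges, while K_{3,3} minus one is a
-- hexagon.

private
  variable
    a b p q r s t : Level
    A : Set a

-- Duplicate-free lists and finite subsets

Unique-resp-↭ : ∀ {xs ys : List A} → xs ↭ ys → Unique xs → Unique ys
Unique-resp-↭ = Permutationₛ.Unique-resp-↭ (setoid _) ∘ ↭⇒↭ₛ

∈⇒↭∷ : ∀ {x : A} {xs} → x ∈ xs → ∃[ ys ] xs ↭ x ∷ ys
∈⇒↭∷ x∈xs with ys , zs , refl ← ∈-∃++ x∈xs = ys ++ zs , shift _ ys zs

∈-∷⁻ : ∀ {x y : A} {xs} → x ≢ y → x ∈ y ∷ xs → x ∈ xs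
∈-∷⁻ x≢y (here x≡y)   = contradiction x≡y x≢y
∈-∷⁻ x≢y (there x∈xs) = x∈xs

Unique-complement : ∀ {xs ys : List A} → Unique xs → (∀ {x} → x ∈ xs → x ∈ ys) → ∃[ zs ] ys ↭ xs ++ zs
Unique-complement [] _ = _ , ↭-refl
Unique-complement {xs = x ∷ xs} (x∉xs ∷ xs!) xs⊆ys with ∈⇒↭∷ (xs⊆ys (here refl))
... | ys′ , ys↭x∷ys′ =
  let zs , ys′↭xs++zs = Unique-complement xs! λ z∈xs →
        ∈-∷⁻ (All.lookup x∉xs z∈xs ∘ sym) (∈-resp-↭ ys↭x∷ys′ (xs⊆ys (there z∈xs)))
  in zs , ↭-trans ys↭x∷ys′ (↭-prep x ys′↭xs++zs)

Unique⇒length≤ : ∀ {xs ys : List A} → Unique xs → (∀ {x} → x ∈ xs → x ∈ ys) → length xs ℕ.≤ length ys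
Unique⇒length≤ {xs = xs} xs! xs⊆ys =
  let zs , ys↭xs++zs = Unique-complement xs! xs⊆ys in
  subst (length xs ℕ.≤_) (sym (trans (↭-length ys↭xs++zs) (Listₚ.length-++ xs))) (ℕₚ.m≤m+n _ _)

length-allFin : ∀ n → length (allFin n) ≡ n
length-allFin n = Listₚ.length-tabulate {n = n} (λ i → i)

Unique⇒length≤n : ∀ {n} {xs : List (Fin n)} → Unique xs → length xs ℕ.≤ n
Unique⇒length≤n {n} {xs} xs! = subst (length xs ℕ.≤_) (length-allFin n) (Unique⇒length≤ xs! λ _ → ∈-allFin _)

module _ {n : ℕ} where
  open import Data.List.Membership.DecPropositional (Finₚ._≟_ {n}) public using (_∈?_)

length<n⇒∃∉ : ∀ {n} (xs : List (Fin n)) → length xs ℕ.< n → ∃[ z ] z ∉ xs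
length<n⇒∃∉ {n} xs |xs|<n = Finₚ.¬∀⟶∃¬ n (_∈ xs) (_∈? xs) λ all∈ →
  ℕₚ.<⇒≱ |xs|<n (subst (ℕ._≤ length xs) (length-allFin n) (Unique⇒length≤ (Uniqueₚ.allFin⁺ n) λ _ → all∈ _))

-- Replaces an argument by contradiction with an early exit. Here `T` will be `LongerCycle C`:
-- either every local test on the cycle passes, or one failure already provides a longer cycle.
All-⊎ : ∀ {P : Pred A p} {Q : Pred A q} {T : Set t} {xs} →
        (∀ {x} → P x → Q x ⊎ T) → All P xs → All Q xs ⊎ T
All-⊎ f []         = inj₁ []
All-⊎ f (px ∷ pxs) with f px | All-⊎ f pxs
... | inj₂ t  | _        = inj₂ t
... | inj₁ _  | inj₂ t   = inj₂ t
... | inj₁ qx | inj₁ qxs = inj₁ (qx ∷ qxs)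

AllPairs-⊎ : ∀ {P : Pred A p} {R : Rel A r} {S : Rel A s} {T : Set t} {xs} →
             (∀ {x y} → P x → P y → R x y → S x y ⊎ T) → All P xs → AllPairs R xs → AllPairs S xs ⊎ T
AllPairs-⊎ f [] [] = inj₁ []
AllPairs-⊎ f (px ∷ pxs) (rx ∷ rxs)
  with All-⊎ (λ (py , rxy) → f px py rxy) (All.zip (pxs , rx)) | AllPairs-⊎ f pxs rxs
... | inj₂ t  | _        = inj₂ t
... | inj₁ _  | inj₂ t   = inj₂ t
... | inj₁ sx | inj₁ sxs = inj₁ (sx ∷ sxs)

∣p∪q∣≤∣p∣+∣q∣ : ∀ {n} (p q : Subset n) → ∣ p Subset.∪ q ∣ ℕ.≤ ∣ p ∣ ℕ.+ ∣ q ∣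
∣p∪q∣≤∣p∣+∣q∣ Vec.[] Vec.[] = z≤n
∣p∪q∣≤∣p∣+∣q∣ (outside Vec.∷ p) (outside Vec.∷ q) = ∣p∪q∣≤∣p∣+∣q∣ p q
∣p∪q∣≤∣p∣+∣q∣ (inside  Vec.∷ p) (outside Vec.∷ q) = s≤s (∣p∪q∣≤∣p∣+∣q∣ p q)
∣p∪q∣≤∣p∣+∣q∣ (outside Vec.∷ p) (inside  Vec.∷ q) =
  ℕₚ.≤-trans (s≤s (∣p∪q∣≤∣p∣+∣q∣ p q)) (ℕₚ.≤-reflexive (sym (ℕₚ.+-suc _ _)))
∣p∪q∣≤∣p∣+∣q∣ (inside  Vec.∷ p) (inside  Vec.∷ q) =
  s≤s (ℕₚ.≤-trans (∣p∪q∣≤∣p∣+∣q∣ p q) (ℕₚ.+-monoʳ-≤ ∣ p ∣ (ℕₚ.n≤1+n _)))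

fromList : ∀ {n} → List (Fin n) → Subset n
fromList []       = Subset.⊥
fromList (x ∷ xs) = ⁅ x ⁆ Subset.∪ fromList xs

∣fromList∣≤length : ∀ {n} (xs : List (Fin n)) → ∣ fromList xs ∣ ℕ.≤ length xs
∣fromList∣≤length {n} []       = ℕₚ.≤-reflexive (Subsetₚ.∣⊥∣≡0 n)
∣fromList∣≤length (x ∷ xs) = ℕₚ.≤-trans (∣p∪q∣≤∣p∣+∣q∣ ⁅ x ⁆ (fromList xs))
  (ℕₚ.+-mono-≤ (ℕₚ.≤-reflexive (Subsetₚ.∣⁅x⁆∣≡1 x)) (∣fromList∣≤length xs))

∈-fromList⁺ : ∀ {n} {x : Fin n} {xs} → x ∈ xs → x Subset.∈ fromList xs
∈-fromList⁺ {x = x} (here refl) = Subsetₚ.x∈p∪q⁺ (inj₁ (Subsetₚ.x∈⁅x⁆ x))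
∈-fromList⁺ (there x∈xs) = Subsetₚ.x∈p∪q⁺ (inj₂ (∈-fromList⁺ x∈xs))

∈-fromList⁻ : ∀ {n} {x : Fin n} xs → x Subset.∈ fromList xs → x ∈ xs
∈-fromList⁻ []       x∈ = ⊥-elim (Subsetₚ.∉⊥ x∈)
∈-fromList⁻ (y ∷ ys) x∈ with Subsetₚ.x∈p∪q⁻ ⁅ y ⁆ (fromList ys) x∈
... | inj₁ x∈⁅y⁆ = here (Subsetₚ.x∈⁅y⁆⇒x≡y y x∈⁅y⁆)
... | inj₂ x∈ys  = there (∈-fromList⁻ ys x∈ys)

-- The Chvátal-Erdős alternative

module LongestCycle {n : ℕ} (G : Graph n) where
  open Graph G renaming (sym to ~-sym; irrefl to ~-irrefl)

  neighbours : Fin n → List (Fin n)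
  neighbours u = filter (u ~?_) (allFin n)

  ∈-neighbours⁺ : ∀ {u v} → u ~ v → v ∈ neighbours u
  ∈-neighbours⁺ {u} u~v = ∈-filter⁺ (u ~?_) (∈-allFin _) u~v

  ∈-neighbours⁻ : ∀ {u v} → v ∈ neighbours u → u ~ v
  ∈-neighbours⁻ {u} v∈ = proj₂ (∈-filter⁻ (u ~?_) {xs = allFin n} v∈)

  -- The form in which connectivity is used: deleting fewer than k vertices leaves a walk from `x`
  -- to `z`, and `H` is carried along it step by step.
  closed-outside-cut : ∀ {k} → IsConnected[_] G k → (L : List (Fin n)) → length L ℕ.< k →
    (H : Fin n → Set) → (∀ {h v} → H h → h ~ v → v ∉ L → H v) →
    ∀ {x z} → H x → x ∉ L → z ∉ L → H z
  closed-outside-cut (_ , connected) L |L|<k H closed {x} {z} Hx x∉L z∉L =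
    go Hx (connected (fromList L) (ℕₚ.≤-<-trans (∣fromList∣≤length L) |L|<k) x z
            (x∉L ∘ ∈-fromList⁻ L) (z∉L ∘ ∈-fromList⁻ L))
    where
    go : ∀ {u} → H u → Star (AdjAvoiding G (fromList L)) u z → H z
    go Hu ε                      = Hu
    go Hu ((_ , v∉L , u~v) ◅ vz) = go (closed Hu u~v (v∉L ∘ ∈-fromList⁺)) vz

  -- Fewer than k neighbours would form a cut isolating `u`, and n > k leaves a further vertex for
  -- it to be separated from.
  k≤degree : ∀ {k} → IsConnected[_] G k → ∀ u → k ℕ.≤ degree G u
  k≤degree {k} conn@(k<n , _) u = ℕₚ.≮⇒≥ λ d<k →
    let z , z∉ = length<n⇒∃∉ (u ∷ neighbours u) (ℕₚ.≤-<-trans d<k k<n)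
        z≡u    = closed-outside-cut conn (neighbours u) d<k (_≡ u)
                   (λ { refl u~v v∉ → contradiction (∈-neighbours⁺ u~v) v∉ })
                   refl (~-irrefl refl ∘ ∈-neighbours⁻) (z∉ ∘ there)
    in z∉ (here z≡u)

  -- A walk indexed by the list of its vertices. Distinctness is kept apart in `Unique`, so that
  -- walks can be joined and reversed freely.
  data Path : Fin n → Fin n → List (Fin n) → Set where
    [-] : ∀ {u} → Path u u (u ∷ [])
    _∷_ : ∀ {u v w l} → u ~ w → Path w v l → Path u v (u ∷ l)

  private
    variable
      u v w x y z : Fin n
      k l m X Y : List (Fin n)

  join : Path u v l → v ~ w → Path w x m → Path u x (l ++ m)
  join [-]       v~w q = v~w ∷ q
  join (u~u′ ∷ p) v~w q = u~u′ ∷ join p v~w q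

  snoc : Path u v l → v ~ w → Path u w (l ∷ʳ w)
  snoc p v~w = join p v~w [-]

  reversePath : Path u v l → Path v u (reverse l)
  reversePath [-] = [-]
  reversePath {l = u ∷ l} (u~w ∷ p) = subst (Path _ _) (sym (Listₚ.unfold-reverse u l)) (snoc (reversePath p) (~-sym u~w))

  compose : ∀ {Q : Fin n → Set} → Path u v l → All Q l → Path v w m → All Q m → ∃[ k ] Path u w k × All Q k
  compose [-]       _          q Qm = _ , q , Qm
  compose (u~u′ ∷ p) (Qu ∷ Ql) q Qm =
    let k , r , Qk = compose p Ql q Qm in _ , u~u′ ∷ r , Qu ∷ Qk

  0<length : Path u v l → 0 ℕ.< length l
  0<length [-]     = s≤s z≤n
  0<length (_ ∷ _) = s≤s z≤n

  suffix : ∀ {Q : Fin n → Set} → Path w v l → Unique l → All Q l → u ∈ l → ∃[ m ] Path u v m × Unique m × All Q m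
  suffix p         l!       Ql (here refl) with p
  ... | [-]     = _ , [-] , l! , Ql
  ... | e ∷ p′  = _ , e ∷ p′ , l! , Ql
  suffix (_ ∷ p) (_ ∷ l!) (_ ∷ Ql) (there u∈l) = suffix p l! Ql u∈l

  -- Loop erasure: if `u` recurs in the simplified tail, the tail is cut back to that occurrence.
  simplify : ∀ {Q : Fin n → Set} → Path u v l → All Q l → ∃[ m ] Path u v m × Unique m × All Q m
  simplify [-] Ql = _ , [-] , [] ∷ [] , Ql
  simplify {u = u} (u~w ∷ p) (Qu ∷ Ql) with simplify p Ql
  ... | m , p′ , m! , Qm with u ∈? m
  ...   | yes u∈m = suffix p′ m! Qm u∈m
  ...   | no  u∉m = u ∷ m , u~w ∷ p′ , Allₚ.¬Any⇒All¬ m u∉m ∷ m! , Qu ∷ Qm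

  -- A cycle may be a single edge traversed back and forth; irreflexivity
  -- excludes one-vertex cycles.
  record Cycle (l : List (Fin n)) : Set where
    constructor mkCycle
    field
      {first last} : Fin n
      path         : Path first last l
      close        : last ~ first
      unique       : Unique l

  LongerCycle : List (Fin n) → Set
  LongerCycle l = ∃[ m ] Cycle m × length l ℕ.< length m

  -- A walk from u through the vertices of the list back to a.
  data Return (a : Fin n) : Fin n → List (Fin n) → Set where
    [_] : u ~ a → Return a u []
    _∷_ : u ~ w → Return a w l → Return a u (w ∷ l)

  Path⇒Return : Path u v l → v ~ w → ∃[ m ] l ≡ u ∷ m × Return w u m
  Path⇒Return [-] v~w = [] , refl , [ v~w ]
  Path⇒Return (u~u′ ∷ p) v~w with m , refl , r ← Path⇒Return p v~w = _ , refl , u~u′ ∷ r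

  Return⇒Linked : Return w u l → Linked _~_ (u ∷ (l ∷ʳ w))
  Return⇒Linked [ e ]   = e ∷ [-]
  Return⇒Linked (e ∷ r) = e ∷ Return⇒Linked r

  _++ᴿ_ : Return w u l → Path w v m → Path u v ((u ∷ l) ++ m)
  [ e ]   ++ᴿ q = e ∷ q
  (e ∷ r) ++ᴿ q = e ∷ (r ++ᴿ q)

  -- Opening a cycle at one or two of its edges

  steps : Fin n → Fin n → List (Fin n) → List (Fin n × Fin n)
  steps a u []      = (u , a) ∷ []
  steps a u (w ∷ l) = (u , w) ∷ steps a w l

  map-proj₁-steps : ∀ a u l → map proj₁ (steps a u l) ≡ u ∷ l
  map-proj₁-steps a u []      = refl
  map-proj₁-steps a u (w ∷ l) = cong (u ∷_) (map-proj₁-steps a w l)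

  map-proj₂-steps : ∀ a u l → map proj₂ (steps a u l) ≡ l ∷ʳ a
  map-proj₂-steps a u []      = refl
  map-proj₂-steps a u (w ∷ l) = cong (w ∷_) (map-proj₂-steps a w l)

  -- The cycle with the edge from `y` to its successor `s` removed: a path through all of `C` from
  -- `s` round to `y`.
  Rotation : List (Fin n) → Fin n × Fin n → Set
  Rotation C (y , s) = ∃[ l ] Path s y l × l ↭ C

  -- The cycle is swept once, with the part already travelled in the path and the part still ahead
  -- in the `Return`; at each step the opened cycle is the part ahead followed by the part
  -- travelled.
  rotations : ∀ {a} → Path a u k → Return a u l → All (Rotation (k ++ l)) (steps a u l)
  rotations {k = k} p [ e ] = (_ , p , ↭-reflexive (sym (Listₚ.++-identityʳ k))) ∷ []
  rotations {k = k} p (_∷_ {w = w} {l = l} e r) =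
    (_ , r ++ᴿ p , ++-comm (w ∷ l) k) ∷
    subst (λ C → All (Rotation C) _) (Listₚ.∷ʳ-++ k w l) (rotations (snoc p e) r)

  -- Removing two edges of the cycle leaves two arcs, one from each successor to the other edge's
  -- tail. An edge between the two successors reconnects them once one arc is reversed.
  Crossing : List (Fin n) → Fin n × Fin n → Fin n × Fin n → Set
  Crossing C (y , s) (y′ , s′) = ∃[ X ] ∃[ Y ] Path s y′ X × Path s′ y Y × X ++ Y ↭ C

  crossings-with : ∀ {a} → Path a u k → Path w v m → Return a v l →
                   All (Crossing (m ++ (l ++ k)) (u , w)) (steps a v l)
  crossings-with p q [ e ] = (_ , _ , q , p , ↭-refl) ∷ []
  crossings-with {k = k} {m = m} p q (_∷_ {w = w} {l = l} e r) =
    (_ , _ , q , r ++ᴿ p , ↭-refl) ∷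
    subst (λ C → All (Crossing C _) _) (Listₚ.∷ʳ-++ m w (l ++ k)) (crossings-with p (snoc q e) r)

  crossings : ∀ {a} → Path a u k → Return a u l → AllPairs (Crossing (k ++ l)) (steps a u l)
  crossings p [ e ] = [] ∷ []
  crossings {k = k} p (_∷_ {w = w} {l = l} e r) =
    All.map (λ (X , Y , pX , pY , perm) → X , Y , pX , pY , ↭-trans perm (++-comm (w ∷ l) k))
      (crossings-with p [-] r) ∷
    subst (λ C → AllPairs (Crossing C) _) (Listₚ.∷ʳ-++ k w l) (crossings (snoc p e) r)

  -- The component of a missed vertex, and detours through it

  record Component (C : List (Fin n)) (x₀ : Fin n) : Set where
    field
      H      : List (Fin n)
      x₀∈H   : x₀ ∈ H
      toRoot : ∀ {h} → h ∈ H → ∃[ l ] Path h x₀ l × All (_∉ C) l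
      closed : ∀ {h v} → h ∈ H → h ~ v → v ∉ C → v ∈ H

  component : ∀ C {x₀} → x₀ ∉ C → Component C x₀
  component C {x₀} x₀∉C = grow n (x₀ ∷ []) ([] ∷ []) (ℕₚ.m≤m+n n 1) (here refl)
      λ { (here refl) → _ , [-] , x₀∉C ∷ [] }
    where
    -- `H` is duplicate-free, so once `fuel` is spent it has n vertices and no new one can be found.
    grow : ∀ fuel H → Unique H → n ℕ.≤ fuel ℕ.+ length H → x₀ ∈ H →
           (∀ {h} → h ∈ H → ∃[ l ] Path h x₀ l × All (_∉ C) l) → Component C x₀
    grow fuel H H! bound x₀∈H toRoot
      with Finₚ.any? (λ v → ¬? (v ∈? C) ×-dec ¬? (v ∈? H) ×-dec Any.any? (v ~?_) H)
    ... | no none = record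
      { H = H ; x₀∈H = x₀∈H ; toRoot = toRoot
      ; closed = λ {h} {v} h∈H h~v v∉C → decidable-stable (v ∈? H) λ v∉H →
          none (v , v∉C , v∉H , lose h∈H (~-sym h~v)) }
    ... | yes (v , v∉C , v∉H , v~H) with fuel
    ...   | zero  = contradiction (Unique⇒length≤n (Allₚ.¬Any⇒All¬ H v∉H ∷ H!)) (ℕₚ.<⇒≱ (s≤s bound))
    ...   | suc f = grow f (v ∷ H) (Allₚ.¬Any⇒All¬ H v∉H ∷ H!)
      (subst (n ℕ.≤_) (sym (ℕₚ.+-suc f (length H))) bound) (there x₀∈H)
      λ { (here refl) → let h , h∈H , v~h = find v~H ; _ , p , avoids = toRoot h∈H in _ , v~h ∷ p , v∉C ∷ avoids
        ; (there h∈H) → toRoot h∈H }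

  module _ {C x₀} (K : Component C x₀) where
    open Component K

    Attached : Fin n → Set
    Attached y = Any (y ~_) H

    attached? : ∀ y → Dec (Attached y)
    attached? y = Any.any? (y ~?_) H

    -- The ends of a path spanning `C` are joined through `H`. The connecting walk goes by way of
    -- the root and may repeat vertices, hence `simplify`; it has at least one vertex, all outside
    -- `C`, so the new cycle is strictly longer.
    detour : Unique C → l ↭ C → Path u v l → Attached v → Attached u → LongerCycle C
    detour {l = l} C! l↭C p v~H u~H =
      let h , h∈H , v~h  = find v~H
          h′ , h′∈H , u~h′ = find u~H
          _ , q , q∉C    = toRoot h∈H
          _ , q′ , q′∉C  = toRoot h′∈H
          _ , r , r∉C    = compose q q∉C (reversePath q′) (All-resp-↭ (↭-sym (↭-reverse _)) q′∉C)
          m , s , m! , s∉C = simplify r r∉C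
      in l ++ m
       , mkCycle (join p v~h s) (~-sym u~h′)
           (Uniqueₚ.++⁺ (Unique-resp-↭ (↭-sym l↭C) C!) m!
             λ (z∈l , z∈m) → All.lookup s∉C z∈m (∈-resp-↭ l↭C z∈l))
       , (begin-strict
           length C              ≡⟨ ↭-length l↭C ⟨
           length l              <⟨ ℕₚ.m<m+n (length l) (0<length s) ⟩
           length l ℕ.+ length m ≡⟨ Listₚ.length-++ l ⟨
           length (l ++ m)       ∎)
      where open ℕₚ.≤-Reasoning

    detour-crossing : Unique C → Crossing C (y , u) (z , v) → Attached y → Attached z → u ~ v → LongerCycle C
    detour-crossing C! (X , Y , pX , pY , XY↭C) y~H z~H u~v =
      detour C! (↭-trans (++⁺ʳ Y (↭-reverse X)) XY↭C) (join (reversePath pX) u~v pY) y~H z~H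

  -- Longer cycle or independent set

  Independent : List (Fin n) → Set
  Independent = AllPairs λ u v → ¬ u ~ v

  IndependentSet : ℕ → Set
  IndependentSet m = ∃[ I ] length I ≡ m × Unique I × Independent I

  -- Two things can spoil the independent set: a vertex and its successor both attached to the
  -- component, or two adjacent successors of attached vertices. Each produces a longer cycle,
  -- through `detour` and `detour-crossing` respectively.
  extend : ∀ {k} → IsConnected[_] G k → ∀ {C} → Cycle C → ∀ {x₀} → x₀ ∉ C →
           LongerCycle C ⊎ IndependentSet (suc k)
  extend {k} conn {C} (mkCycle {a} p close C!) {x₀} x₀∉C
    with R , refl , r ← Path⇒Return p close
    = let K = component C x₀∉C in [ separated K , inj₁ ]′ (noneConsecutive K)
    where
    S : List (Fin n × Fin n)
    S = steps a a R

    NotConsecutive : Component C x₀ → Fin n × Fin n → Set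
    NotConsecutive K (y , s) = Attached K y → ¬ Attached K s

    noneConsecutive : (K : Component C x₀) → All (NotConsecutive K) S ⊎ LongerCycle C
    noneConsecutive K = All-⊎ test (rotations [-] r)
      where
      test : ∀ {ys} → Rotation C ys → NotConsecutive K ys ⊎ LongerCycle C
      test {y , s} (l , q , l↭C) with attached? K y ×-dec attached? K s
      ... | yes (y~H , s~H) = inj₂ (detour K C! l↭C q y~H s~H)
      ... | no  none        = inj₁ λ y~H s~H → none (y~H , s~H)

    separated : (K : Component C x₀) → All (NotConsecutive K) S →
                LongerCycle C ⊎ IndependentSet (suc k)
    separated K nc = [ inj₂ ∘ independent , inj₁ ]′
      (AllPairs-⊎ test (Allₚ.all-filter (attached? K ∘ proj₁) S)
        (AllPairsₚ.filter⁺ (attached? K ∘ proj₁) (crossings [-] r)))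
      where
      open Component K

      P : List (Fin n × Fin n)
      P = filter (attached? K ∘ proj₁) S

      -- `L` collects the attached vertices and is the candidate cut; the tail of `I₀` collects
      -- their successors and has the same length.
      I₀ L : List (Fin n)
      I₀ = x₀ ∷ map proj₂ P
      L  = map proj₁ P

      test : ∀ {p q} → Attached K (proj₁ p) → Attached K (proj₁ q) → Crossing C p q →
             ¬ proj₂ p ~ proj₂ q ⊎ LongerCycle C
      test {_ , u} {_ , v} y~H z~H c with u ~? v
      ... | yes u~v = inj₂ (detour-crossing K C! c y~H z~H u~v)
      ... | no  u≁v = inj₁ u≁v

      ∷↭∷ʳ : a ∷ R ↭ R ∷ʳ a
      ∷↭∷ʳ = ++-comm (a ∷ []) R

      proj₂∈C : ∀ {ys} → ys ∈ S → proj₂ ys ∈ C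
      proj₂∈C ys∈S = ∈-resp-↭ (↭-sym ∷↭∷ʳ) (subst (_ ∈_) (map-proj₂-steps a a R) (∈-map⁺ proj₂ ys∈S))

      P⊆S : ∀ {ys} → ys ∈ P → ys ∈ S × Attached K (proj₁ ys)
      P⊆S = ∈-filter⁻ (attached? K ∘ proj₁) {xs = S}

      successor : ∀ {s} → s ∈ map proj₂ P → s ∈ C × ¬ Attached K s
      successor s∈ with ys , ys∈P , refl ← ∈-map⁻ proj₂ s∈ =
        let ys∈S , y~H = P⊆S ys∈P in proj₂∈C ys∈S , All.lookup nc ys∈S y~H

      x₀≁ : All (λ s → ¬ x₀ ~ s) (map proj₂ P)
      x₀≁ = All.tabulate λ s∈ x₀~s → proj₂ (successor s∈) (lose x₀∈H (~-sym x₀~s))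

      I₀! : Unique I₀
      I₀! = All.tabulate (λ { s∈ refl → x₀∉C (proj₁ (successor s∈)) }) ∷
            AllPairsₚ.map⁺ (AllPairsₚ.filter⁺ _ (AllPairsₚ.map⁻
              (subst Unique (sym (map-proj₂-steps a a R)) (Unique-resp-↭ ∷↭∷ʳ C!))))

      attached∈L : ∀ {v} → v ∈ C → Attached K v → v ∈ L
      attached∈L v∈C v~H with ys , ys∈S , refl ← ∈-map⁻ proj₁ (subst (_ ∈_) (sym (map-proj₁-steps a a R)) v∈C) =
        ∈-map⁺ proj₁ (∈-filter⁺ (attached? K ∘ proj₁) ys∈S v~H)

      ∈L⇒ : ∀ {v} → v ∈ L → v ∈ C × Attached K v
      ∈L⇒ v∈L with ys , ys∈P , refl ← ∈-map⁻ proj₁ v∈L =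
        let ys∈S , y~H = P⊆S ys∈P
        in subst (_ ∈_) (map-proj₁-steps a a R) (∈-map⁺ proj₁ ys∈S) , y~H

      -- Guarantees that `L` has something to separate from `H`: if `a` is attached, its successor
      -- is not.
      someUnattached : ∃[ z ] z ∈ C × ¬ Attached K z
      someUnattached with attached? K a
      ... | no  a≁H = a , here refl , a≁H
      ... | yes a~H with ys , ys∈S , refl ← ∈-map⁻ proj₁ (subst (a ∈_) (sym (map-proj₁-steps a a R)) (here refl)) =
        proj₂ ys , proj₂∈C ys∈S , All.lookup nc ys∈S a~H

      H∩C=∅ : ∀ {h} → h ∈ H → h ∉ C
      H∩C=∅ h∈H with toRoot h∈H
      ... | _ , [-]   , h∉C ∷ _ = h∉C
      ... | _ , _ ∷ _ , h∉C ∷ _ = h∉C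

      k≤|P| : k ℕ.≤ length P
      -- Edges leaving `H` end in `L`. With fewer than k vertices in `L`, connectivity would
      -- therefore put `z`, a vertex of the cycle, into `H`.
      k≤|P| = ℕₚ.≮⇒≥ λ |P|<k →
        let z , z∈C , z≁H = someUnattached
            z∈H = closed-outside-cut conn L (subst (ℕ._< k) (sym (Listₚ.length-map proj₁ P)) |P|<k) (_∈ H)
                    (λ {h} {v} h∈H h~v v∉L → closed h∈H h~v λ v∈C → v∉L (attached∈L v∈C (lose h∈H (~-sym h~v))))
                    x₀∈H (x₀∉C ∘ proj₁ ∘ ∈L⇒) (z≁H ∘ proj₂ ∘ ∈L⇒)
        in H∩C=∅ z∈H z∈C

      |I| : length (take (suc k) I₀) ≡ suc k
      |I| = trans (Listₚ.length-take (suc k) I₀)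
        (ℕₚ.m≤n⇒m⊓n≡m (s≤s (subst (k ℕ.≤_) (sym (Listₚ.length-map proj₂ P)) k≤|P|)))

      independent : AllPairs (λ p q → ¬ proj₂ p ~ proj₂ q) P → IndependentSet (suc k)
      independent P≁ = take (suc k) I₀ , |I| , Uniqueₚ.take⁺ (suc k) I₀! ,
        AllPairsₚ.take⁺ (suc k) (x₀≁ ∷ AllPairsₚ.map⁺ P≁)

  Cycle⇒Hamiltonian : 3 ℕ.≤ n → Cycle l → (∀ u → u ∈ l) → Hamiltonian G
  Cycle⇒Hamiltonian 3≤n (mkCycle {a} p close l!) spanning with R , refl , r ← Path⇒Return p close =
    a , R , record
      { length≥3 = ℕₚ.≤-trans 3≤n
          (subst (ℕ._≤ length (a ∷ R)) (length-allFin n) (Unique⇒length≤ (Uniqueₚ.allFin⁺ n) λ _ → spanning _))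
      ; distinct = l!
      ; adjacent = Return⇒Linked r } , spanning

  chvátal-erdős : ∀ {k} → 2 ℕ.≤ k → 3 ℕ.≤ n → IsConnected[_] G k →
                  Hamiltonian G ⊎ IndependentSet (suc k)
  chvátal-erdős {k} 2≤k 3≤n conn = start (length<n⇒∃∉ [] (ℕₚ.≤-trans (s≤s z≤n) 3≤n))
    where
    -- The bound says that `fuel` covers the vertices still missing; at zero the cycle has n
    -- distinct vertices and `x₀` cannot exist.
    improve : ∀ fuel → Cycle l → n ℕ.≤ fuel ℕ.+ length l →
              Hamiltonian G ⊎ IndependentSet (suc k)
    improve {l} fuel c bound with Finₚ.any? (λ u → ¬? (u ∈? l))
    ... | no all = inj₁ (Cycle⇒Hamiltonian 3≤n c λ u → decidable-stable (u ∈? l) λ u∉l → all (u , u∉l))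
    ... | yes (x₀ , x₀∉l) with fuel | extend conn c x₀∉l
    ...   | _     | inj₂ I = inj₂ I
    ...   | zero  | inj₁ _ = contradiction (Unique⇒length≤n (Allₚ.¬Any⇒All¬ l x₀∉l ∷ Cycle.unique c)) (ℕₚ.<⇒≱ (s≤s bound))
    ...   | suc f | inj₁ (m , c′ , l<m) = improve f c′
      (ℕₚ.≤-trans bound (ℕₚ.≤-trans (ℕₚ.≤-reflexive (sym (ℕₚ.+-suc f _))) (ℕₚ.+-monoʳ-≤ f l<m)))

    start : ∃[ u ] u ∉ [] → Hamiltonian G ⊎ IndependentSet (suc k)
    start (u , _) with neighbours u in eq | k≤degree conn u
    ... | []    | k≤0 = contradiction (ℕₚ.≤-trans 2≤k k≤0) λ ()
    -- The edge between `u` and `v`, taken as a cycle on two vertices, is the starting point.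
    ... | v ∷ _ | _   = improve n (mkCycle (u~v ∷ [-]) (~-sym u~v) ((u≢v ∷ []) ∷ [] ∷ [])) (ℕₚ.m≤m+n n 2)
      where
      u~v : u ~ v
      u~v = ∈-neighbours⁻ (subst (v ∈_) (sym eq) (here refl))
      u≢v : u ≢ v
      u≢v u≡v = ~-irrefl u≡v u~v

-- Sums over lists, and degree sums over an independent set and its complement

Σ : List A → (A → ℕ) → ℕ
Σ xs f = sum (map f xs)

Σ-++ : ∀ xs {ys : List A} {f} → Σ (xs ++ ys) f ≡ Σ xs f ℕ.+ Σ ys f
Σ-++ xs {ys} {f} = trans (cong sum (Listₚ.map-++ f xs ys)) (sum-++ (map f xs) (map f ys))

Σ-↭ : ∀ {xs ys : List A} {f} → xs ↭ ys → Σ xs f ≡ Σ ys f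
Σ-↭ xs↭ys = sum-↭ (map⁺ _ xs↭ys)

Σ-cong : ∀ (xs : List A) {f g} → (∀ {x} → x ∈ xs → f x ≡ g x) → Σ xs f ≡ Σ xs g
Σ-cong []       f≡g = refl
Σ-cong (x ∷ xs) f≡g = cong₂ ℕ._+_ (f≡g (here refl)) (Σ-cong xs (f≡g ∘ there))

Σ-mono : ∀ {xs : List A} {f g} → (∀ {x} → x ∈ xs → f x ℕ.≤ g x) → Σ xs f ℕ.≤ Σ xs g
Σ-mono {xs = []}     f≤g = z≤n
Σ-mono {xs = x ∷ xs} f≤g = ℕₚ.+-mono-≤ (f≤g (here refl)) (Σ-mono (f≤g ∘ there))

-- Slack in a single term would make the sums differ. This extracts pointwise information from the
-- equality cases: regularity, no edges inside J, full adjacency across the parts.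
Σ-tight : ∀ {xs : List A} {f g} → (∀ {x} → x ∈ xs → f x ℕ.≤ g x) → Σ xs g ℕ.≤ Σ xs f →
          ∀ {x} → x ∈ xs → f x ≡ g x
Σ-tight {xs = x ∷ xs} {f} {g} f≤g Σg≤Σf (here refl) = ℕₚ.≤-antisym (f≤g (here refl))
  (ℕₚ.+-cancelʳ-≤ (Σ xs f) (g x) (f x) (ℕₚ.≤-trans (ℕₚ.+-monoʳ-≤ (g x) (Σ-mono (f≤g ∘ there))) Σg≤Σf))
Σ-tight {xs = x ∷ xs} {f} {g} f≤g Σg≤Σf (there y∈xs) = Σ-tight (f≤g ∘ there)
  (ℕₚ.+-cancelˡ-≤ (f x) (Σ xs g) (Σ xs f) (ℕₚ.≤-trans (ℕₚ.+-monoˡ-≤ (Σ xs g) (f≤g (here refl))) Σg≤Σf)) y∈xs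

Σ-+ : ∀ (xs : List A) f g → Σ xs (λ x → f x ℕ.+ g x) ≡ Σ xs f ℕ.+ Σ xs g
Σ-+ []       f g = refl
Σ-+ (x ∷ xs) f g = trans (cong (f x ℕ.+ g x ℕ.+_) (Σ-+ xs f g)) (interchange (f x) (g x) (Σ xs f) (Σ xs g))

Σ-const : ∀ (xs : List A) c → Σ xs (λ _ → c) ≡ length xs ℕ.* c
Σ-const []       c = refl
Σ-const (x ∷ xs) c = cong (c ℕ.+_) (Σ-const xs c)

Σ-*ˡ : ∀ (xs : List A) c f → Σ xs (λ x → c ℕ.* f x) ≡ c ℕ.* Σ xs f
Σ-*ˡ []       c f = sym (ℕₚ.*-zeroʳ c)
Σ-*ˡ (x ∷ xs) c f = trans (cong (c ℕ.* f x ℕ.+_) (Σ-*ˡ xs c f)) (sym (ℕₚ.*-distribˡ-+ c (f x) (Σ xs f)))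

Σ-swap : ∀ {B : Set b} (xs : List A) (ys : List B) (f : A → B → ℕ) → Σ xs (λ x → Σ ys (f x)) ≡ Σ ys (λ y → Σ xs (λ x → f x y))
Σ-swap []       ys f = sym (trans (Σ-const ys 0) (ℕₚ.*-zeroʳ (length ys)))
Σ-swap (x ∷ xs) ys f = trans (cong (Σ ys (f x) ℕ.+_) (Σ-swap xs ys f)) (sym (Σ-+ ys (f x) _))

𝟙 : ∀ {P : Set p} → Dec P → ℕ
𝟙 P? = if does P? then 1 else 0

𝟙-yes : ∀ {P : Set p} (P? : Dec P) → P → 𝟙 P? ≡ 1
𝟙-yes P? P rewrite dec-true P? P = refl

𝟙-no : ∀ {P : Set p} (P? : Dec P) → ¬ P → 𝟙 P? ≡ 0
𝟙-no P? ¬P rewrite dec-false P? ¬P = refl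

𝟙≡1⇒ : ∀ {P : Set p} (P? : Dec P) → 𝟙 P? ≡ 1 → P
𝟙≡1⇒ (yes P) _ = P

𝟙≤1 : ∀ {P : Set p} (P? : Dec P) → 𝟙 P? ℕ.≤ 1
𝟙≤1 (yes _) = ℕₚ.≤-refl
𝟙≤1 (no _)  = z≤n

length-filter : ∀ {P : Pred A p} (P? : ∀ x → Dec (P x)) xs → length (filter P? xs) ≡ Σ xs (𝟙 ∘ P?)
length-filter P? [] = refl
length-filter P? (x ∷ xs) with P? x
... | yes _ = cong suc (length-filter P? xs)
... | no  _ = length-filter P? xs

Σ-cartesianProduct : ∀ {B : Set b} (xs : List A) (ys : List B) f →
                     Σ (cartesianProduct xs ys) f ≡ Σ xs (λ x → Σ ys (λ y → f (x , y)))
Σ-cartesianProduct []       ys f = refl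
Σ-cartesianProduct (x ∷ xs) ys f = trans (Σ-++ (map (x ,_) ys))
  (cong₂ ℕ._+_ (cong sum (sym (Listₚ.map-∘ ys))) (Σ-cartesianProduct xs ys f))

all-counted : ∀ {P : Pred A p} (P? : ∀ x → Dec (P x)) {xs} → length xs ℕ.≤ Σ xs (𝟙 ∘ P?) → ∀ {x} → x ∈ xs → P x
all-counted P? {xs} |xs|≤Σ {x} x∈xs = 𝟙≡1⇒ (P? x) (Σ-tight (λ {y} _ → 𝟙≤1 (P? y))
  (subst (ℕ._≤ Σ xs (𝟙 ∘ P?)) (sym (trans (Σ-const xs 1) (ℕₚ.*-identityʳ _))) |xs|≤Σ) x∈xs)

all-but-one-counted : ∀ {P : Pred A p} (P? : ∀ x → Dec (P x)) {xs} → length xs ≡ suc (Σ xs (𝟙 ∘ P?)) →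
  ∃[ y ] y ∈ xs × ¬ P y × (∀ {x} → x ∈ xs → x ≢ y → P x)
all-but-one-counted P? {x ∷ xs} eq with P? x
... | no ¬Px = x , here refl , ¬Px , λ z∈ z≢x → all-counted P? (ℕₚ.≤-reflexive (ℕₚ.suc-injective eq)) (∈-∷⁻ z≢x z∈)
... | yes Px with y , y∈xs , ¬Py , rest ← all-but-one-counted P? (ℕₚ.suc-injective eq) =
  y , there y∈xs , ¬Py , λ { (here refl) _ → Px ; (there z∈xs) z≢y → rest z∈xs z≢y }

AllPairs-universal : ∀ {R : Rel A r} xs → (∀ {x y} → x ∈ xs → y ∈ xs → R x y) → AllPairs R xs
AllPairs-universal []       f = []
AllPairs-universal (x ∷ xs) f = All.tabulate (f (here refl) ∘ there) ∷ AllPairs-universal xs λ x∈ y∈ → f (there x∈) (there y∈)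

pairUp : ∀ {B : Set b} (xs : List A) (ys : List B) → length xs ≡ length ys →
         ∃[ ps ] map proj₁ ps ≡ xs × map proj₂ ps ≡ ys
pairUp []       []       _  = [] , refl , refl
pairUp (x ∷ xs) (y ∷ ys) eq with ps , refl , refl ← pairUp xs ys (ℕₚ.suc-injective eq) = (x , y) ∷ ps , refl , refl

module Bipartite {n : ℕ} (G : Graph n) where
  open Graph G renaming (sym to ~-sym; irrefl to ~-irrefl)
  open LongestCycle G

  adj : Fin n → Fin n → ℕ
  adj u v = 𝟙 (u ~? v)

  adj-sym : ∀ u v → adj u v ≡ adj v u
  adj-sym u v with u ~? v
  ... | yes u~v = sym (𝟙-yes (v ~? u) (~-sym u~v))
  ... | no  u≁v = sym (𝟙-no (v ~? u) (u≁v ∘ ~-sym))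

  degree-Σ : ∀ u → degree G u ≡ Σ (allFin n) (adj u)
  degree-Σ u = length-filter (u ~?_) (allFin n)

  adj↑ : Fin n → Fin n → ℕ
  adj↑ u v = 𝟙 ((u Fin.<? v) ×-dec (u ~? v))

  -- Exactly one orientation of an adjacent pair is increasing, which is how `edges` lists it;
  -- summing over all pairs gives the handshake identity.
  adj-orient : ∀ u v → adj u v ≡ adj↑ u v ℕ.+ adj↑ v u
  adj-orient u v with Finₚ.<-cmp u v
  ... | tri< u<v _ v≮u rewrite dec-true (u Fin.<? v) u<v | dec-false (v Fin.<? u) v≮u = sym (ℕₚ.+-identityʳ _)
  ... | tri> u≮v _ v<u rewrite dec-true (v Fin.<? u) v<u | dec-false (u Fin.<? v) u≮v = adj-sym u v
  ... | tri≈ u≮v refl _ rewrite dec-false (u Fin.<? u) u≮v = 𝟙-no (u ~? u) (~-irrefl refl)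

  edgeCount-Σ : edgeCount G ≡ Σ (allFin n) (λ u → Σ (allFin n) (adj↑ u))
  edgeCount-Σ = trans (length-filter _ (cartesianProduct (allFin n) (allFin n)))
                      (Σ-cartesianProduct (allFin n) (allFin n) _)

  handshake : Σ (allFin n) (degree G) ≡ edgeCount G ℕ.+ edgeCount G
  handshake = begin
    Σ V (degree G)                                            ≡⟨ Σ-cong V (λ {u} _ → degree-Σ u) ⟩
    Σ V (λ u → Σ V (adj u))                                   ≡⟨ Σ-cong V (λ {u} _ → Σ-cong V λ {v} _ → adj-orient u v) ⟩
    Σ V (λ u → Σ V (λ v → adj↑ u v ℕ.+ adj↑ v u))             ≡⟨ Σ-cong V (λ {u} _ → Σ-+ V (adj↑ u) (λ v → adj↑ v u)) ⟩
    Σ V (λ u → Σ V (adj↑ u) ℕ.+ Σ V (λ v → adj↑ v u))         ≡⟨ Σ-+ V _ _ ⟩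
    Σ V (λ u → Σ V (adj↑ u)) ℕ.+ Σ V (λ u → Σ V (λ v → adj↑ v u)) ≡⟨ cong₂ ℕ._+_ edgeCount-Σ (trans edgeCount-Σ (Σ-swap V V adj↑)) ⟨
    edgeCount G ℕ.+ edgeCount G                               ∎
    where
    open ≡-Reasoning
    V : List (Fin n)
    V = allFin n

  Independent-∈ : ∀ {I u v} → Independent I → u ∈ I → v ∈ I → ¬ u ~ v
  Independent-∈ (_ ∷ _)    (here refl) (here refl) = ~-irrefl refl
  Independent-∈ (u≁ ∷ _)   (here refl) (there v∈)  = All.lookup u≁ v∈
  Independent-∈ (v≁ ∷ _)   (there u∈)  (here refl) = All.lookup v≁ u∈ ∘ ~-sym
  Independent-∈ (_ ∷ ind)  (there u∈)  (there v∈)  = Independent-∈ ind u∈ v∈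

  module Split {I J : List (Fin n)} (ind : Independent I) (V↭I++J : allFin n ↭ I ++ J) where

    Σ-split : ∀ f → Σ (allFin n) f ≡ Σ I f ℕ.+ Σ J f
    Σ-split f = trans (Σ-↭ V↭I++J) (Σ-++ I)

    degree-split : ∀ u → degree G u ≡ Σ I (adj u) ℕ.+ Σ J (adj u)
    degree-split u = trans (degree-Σ u) (Σ-split (adj u))

    degree-∈I : ∀ {x} → x ∈ I → degree G x ≡ Σ J (adj x)
    degree-∈I {x} x∈I = trans (degree-split x) (cong (ℕ._+ Σ J (adj x))
      (trans (Σ-cong I λ {y} y∈I → 𝟙-no (x ~? y) (Independent-∈ ind x∈I y∈I))
             (trans (Σ-const I 0) (ℕₚ.*-zeroʳ (length I)))))

    ΣI ΣJ ΣJJ : ℕ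
    ΣI  = Σ I (degree G)
    ΣJ  = Σ J (degree G)
    ΣJJ = Σ J (λ y → Σ J (adj y))

    -- Double counting of the edges between I and J: as I is independent, `ΣI` counts them all. The
    -- rest, `ΣJJ`, counts each edge inside J twice.
    ΣJ≡ΣI+ΣJJ : ΣJ ≡ ΣI ℕ.+ ΣJJ
    ΣJ≡ΣI+ΣJJ = begin
      ΣJ                                                     ≡⟨ Σ-cong J (λ {y} _ → degree-split y) ⟩
      Σ J (λ y → Σ I (adj y) ℕ.+ Σ J (adj y))                ≡⟨ Σ-+ J _ _ ⟩
      Σ J (λ y → Σ I (adj y)) ℕ.+ ΣJJ                        ≡⟨ cong (ℕ._+ ΣJJ) (Σ-swap J I adj) ⟩
      Σ I (λ x → Σ J (λ y → adj y x)) ℕ.+ ΣJJ                ≡⟨ cong (ℕ._+ ΣJJ) (Σ-cong I λ {x} x∈I →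
          trans (Σ-cong J λ {y} _ → adj-sym y x) (sym (degree-∈I x∈I))) ⟩
      ΣI ℕ.+ ΣJJ                                             ∎
      where open ≡-Reasoning

    2e≡ΣI+ΣJ : edgeCount G ℕ.+ edgeCount G ≡ ΣI ℕ.+ ΣJ
    2e≡ΣI+ΣJ = trans (sym handshake) (Σ-split (degree G))

    ΣI≤ΣJ : ΣI ℕ.≤ ΣJ
    ΣI≤ΣJ = subst (ΣI ℕ.≤_) (sym ΣJ≡ΣI+ΣJJ) (ℕₚ.m≤m+n ΣI ΣJJ)

    -- The edge count is the mean of `ΣI` and `ΣJ`, so it lies between them.
    ΣI≤e : ΣI ℕ.≤ edgeCount G
    ΣI≤e = ℕₚ.≮⇒≥ λ e<ΣI → ℕₚ.<⇒≢ (ℕₚ.+-mono-< e<ΣI (ℕₚ.<-≤-trans e<ΣI ΣI≤ΣJ)) 2e≡ΣI+ΣJ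

    e≤ΣJ : edgeCount G ℕ.≤ ΣJ
    e≤ΣJ = ℕₚ.≮⇒≥ λ ΣJ<e → ℕₚ.<⇒≢ (ℕₚ.+-mono-< (ℕₚ.≤-<-trans ΣI≤ΣJ ΣJ<e) ΣJ<e) (sym 2e≡ΣI+ΣJ)

    n≡|I|+|J| : n ≡ length I ℕ.+ length J
    n≡|I|+|J| = trans (sym (length-allFin n)) (trans (↭-length V↭I++J) (Listₚ.length-++ I))

  -- Hamiltonian cycles in nearly complete balanced bipartite graphs

  Linked-pairs : Rel (Fin n × Fin n) _
  Linked-pairs (x , y) (x′ , y′) = (x ~ y′) × (x′ ~ y)

  -- Each `x` is paired with its only non-neighbour in J. Removing such a pair preserves the
  -- hypotheses, because no other vertex of I misses the same `y`.
  matchNonadjacent : ∀ I J → Unique I → Unique J → length I ≡ length J →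
    (∀ {x} → x ∈ I → ∃[ y ] y ∈ J × ¬ x ~ y × (∀ {y′} → y′ ∈ J → y′ ≢ y → x ~ y′)) →
    (∀ {x x′ y} → x ∈ I → x′ ∈ I → y ∈ J → ¬ x ~ y → ¬ x′ ~ y → x ≡ x′) →
    ∃[ ps ] map proj₁ ps ≡ I × map proj₂ ps ↭ J × AllPairs Linked-pairs ps
  matchNonadjacent [] [] _ _ _ _ _ = [] , refl , ↭-refl , []
  matchNonadjacent (x ∷ I) J (x∉I ∷ I!) J! |I|≡|J| partner unique
    with y , y∈J , x≁y , x~ ← partner (here refl)
    with J′ , J↭y∷J′ ← ∈⇒↭∷ y∈J
    with y∉J′ ∷ J′! ← Unique-resp-↭ J↭y∷J′ J!
    = extendMatching (matchNonadjacent I J′ I! J′! (ℕₚ.suc-injective (trans |I|≡|J| (↭-length J↭y∷J′)))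
        partner′ λ z∈ z′∈ w∈ → unique (there z∈) (there z′∈) (J′⊆J w∈))
    where
    J′⊆J : ∀ {z} → z ∈ J′ → z ∈ J
    J′⊆J z∈ = ∈-resp-↭ (↭-sym J↭y∷J′) (there z∈)

    x≢ : ∀ {x′} → x′ ∈ I → x ≢ x′
    x≢ = All.lookup x∉I

    partner′ : ∀ {x′} → x′ ∈ I → ∃[ y′ ] y′ ∈ J′ × ¬ x′ ~ y′ × (∀ {z} → z ∈ J′ → z ≢ y′ → x′ ~ z)
    partner′ x′∈I with y′ , y′∈J , x′≁y′ , x′~ ← partner (there x′∈I) =
      y′ , ∈-∷⁻ (λ { refl → x≢ x′∈I (unique (here refl) (there x′∈I) y∈J x≁y x′≁y′) }) (∈-resp-↭ J↭y∷J′ y′∈J)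
      , x′≁y′ , x′~ ∘ J′⊆J

    extendMatching : ∃[ ps ] map proj₁ ps ≡ I × map proj₂ ps ↭ J′ × AllPairs Linked-pairs ps →
                     ∃[ ps ] map proj₁ ps ≡ x ∷ I × map proj₂ ps ↭ J × AllPairs Linked-pairs ps
    extendMatching (ps , eq₁ , eq₂ , linked) =
      (x , y) ∷ ps , cong (x ∷_) eq₁ , ↭-trans (↭-prep y eq₂) (↭-sym J↭y∷J′)
      , All.tabulate (λ {(x′ , y′)} p∈ →
          let x′∈I  = subst (x′ ∈_) eq₁ (∈-map⁺ proj₁ p∈)
              y′∈J′ = ∈-resp-↭ eq₂ (∈-map⁺ proj₂ p∈)
          in x~ (J′⊆J y′∈J′) (All.lookup y∉J′ y′∈J′ ∘ sym)
           , decidable-stable (x′ ~? y) λ x′≁y → x≢ x′∈I (unique (here refl) (there x′∈I) y∈J x≁y x′≁y))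
        ∷ linked

  -- The vertex order x₀ y₂ x₁ y₃ x₂ y₄ … of a cycle through the pairs (xᵢ , yᵢ),
  -- with y₀ and y₁ filling the last two gaps.
  zigzag : (y₀ y₁ : Fin n) (p q : Fin n × Fin n) → List (Fin n × Fin n) → List (Fin n)
  zigzag y₀ y₁ p q []       = proj₁ p ∷ y₀ ∷ proj₁ q ∷ y₁ ∷ []
  zigzag y₀ y₁ p q (r ∷ rs) = proj₁ p ∷ proj₂ r ∷ zigzag y₀ y₁ q r rs

  zigzag-↭ : ∀ y₀ y₁ p q rs → zigzag y₀ y₁ p q rs ↭ map proj₁ (p ∷ q ∷ rs) ++ (y₀ ∷ y₁ ∷ map proj₂ rs)
  zigzag-↭ y₀ y₁ p q []       = ↭-prep _ (↭-swap _ _ ↭-refl)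
  zigzag-↭ y₀ y₁ p q (r ∷ rs) = ↭-prep _ (begin
    proj₂ r ∷ zigzag y₀ y₁ q r rs              ↭⟨ ↭-prep _ (zigzag-↭ y₀ y₁ q r rs) ⟩
    proj₂ r ∷ (X ++ (y₀ ∷ y₁ ∷ Y))             ≡⟨ cong (proj₂ r ∷_) (Listₚ.++-assoc X (y₀ ∷ y₁ ∷ []) Y) ⟨
    proj₂ r ∷ ((X ++ (y₀ ∷ y₁ ∷ [])) ++ Y)     ↭⟨ shift (proj₂ r) (X ++ (y₀ ∷ y₁ ∷ [])) Y ⟨
    (X ++ (y₀ ∷ y₁ ∷ [])) ++ (proj₂ r ∷ Y)     ≡⟨ Listₚ.++-assoc X (y₀ ∷ y₁ ∷ []) (proj₂ r ∷ Y) ⟩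
    X ++ (y₀ ∷ y₁ ∷ proj₂ r ∷ Y)               ∎)
    where
    open PermutationReasoning
    X Y : List (Fin n)
    X = map proj₁ (q ∷ r ∷ rs)
    Y = map proj₂ rs

  -- Consecutive vertices always come from different pairs: yᵢ₊₂ lies between xᵢ and xᵢ₊₁, y₀
  -- between the last two x's, and y₁ after the last one.
  zigzag-Path : ∀ {p₀ p₁ p q rs} → All (Linked-pairs p₀) (p ∷ q ∷ rs) → All (Linked-pairs p₁) (q ∷ rs) →
                AllPairs Linked-pairs (p ∷ q ∷ rs) → Path (proj₁ p) (proj₂ p₁) (zigzag (proj₂ p₀) (proj₂ p₁) p q rs)
  zigzag-Path {rs = []} ((_ , x~y₀) ∷ (_ , x′~y₀) ∷ _) ((_ , x′~y₁) ∷ _) _ =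
    x~y₀ ∷ ~-sym x′~y₀ ∷ x′~y₁ ∷ [-]
  zigzag-Path {rs = r ∷ rs} (_ ∷ lp₀) (_ ∷ lp₁) ((_ ∷ (x~y″ , _) ∷ _) ∷ lq@(((x′~y″ , _) ∷ _) ∷ _)) =
    x~y″ ∷ ~-sym x′~y″ ∷ zigzag-Path lp₀ lp₁ lq

  -- `Linked-pairs` says nothing about adjacency inside a pair, so the complete bipartite graph and
  -- the one minus a perfect matching are handled together.
  linkedPairs⇒Hamiltonian : ∀ {ps} → 3 ℕ.≤ length ps → AllPairs Linked-pairs ps →
    allFin n ↭ map proj₁ ps ++ map proj₂ ps → 3 ℕ.≤ n → Hamiltonian G
  linkedPairs⇒Hamiltonian {_ ∷ []} (s≤s ())
  linkedPairs⇒Hamiltonian {_ ∷ _ ∷ []} (s≤s (s≤s ()))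
  linkedPairs⇒Hamiltonian {p₀ ∷ p₁ ∷ r ∷ rs} _
    (l₀@((_ , x₁~y₀) ∷ (x₀~y₂ , _) ∷ _) ∷ l₁@(((x₁~y₂ , _) ∷ _) ∷ _)) V↭ 3≤n =
    Cycle⇒Hamiltonian 3≤n
      -- The two edges at y₂ are written out because x₀ is not linked to its own pair; from x₁ on,
      -- the first pair is linked to all that remain.
      (mkCycle (x₀~y₂ ∷ ~-sym x₁~y₂ ∷ zigzag-Path l₀ (AllPairs.head l₁) l₁) (~-sym (proj₁ (All.head l₀)))
        (Unique-resp-↭ V↭zigzag (Uniqueₚ.allFin⁺ n)))
      λ u → ∈-resp-↭ V↭zigzag (∈-allFin u)
    where
    V↭zigzag : allFin n ↭ zigzag (proj₂ p₀) (proj₂ p₁) p₀ p₁ (r ∷ rs)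
    V↭zigzag = ↭-trans V↭ (↭-sym (zigzag-↭ (proj₂ p₀) (proj₂ p₁) p₀ p₁ (r ∷ rs)))

  -- Equality in ΣI ≤ e forces G to be bipartite with both parts of size k + 1;
  -- as the degree is at least k, non-adjacency across the parts is either empty
  -- or a perfect matching.
  extremal⇒Hamiltonian : ∀ {k δ I} → 2 ℕ.≤ k → 3 ℕ.≤ n → k ℕ.≤ δ → length I ≡ suc k → Unique I → Independent I →
    (∀ u → degree G u ≡ δ) → edgeCount G ≡ suc k ℕ.* δ → Hamiltonian G
  extremal⇒Hamiltonian {k} {δ} {I} 2≤k 3≤n k≤δ |I| I! ind regular e≡ with Unique-complement {ys = allFin n} I! (λ _ → ∈-allFin _)
  ... | J , V↭I++J = finish (δ ℕ.<? suc k)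
    where
    open Split ind V↭I++J

    instance
      δ≢0 : ℕ.NonZero δ
      δ≢0 = ℕ.>-nonZero (ℕₚ.≤-trans (s≤s z≤n) (ℕₚ.≤-trans 2≤k k≤δ))

    ΣI≡ : ΣI ≡ suc k ℕ.* δ
    ΣI≡ = trans (Σ-cong I λ {x} _ → regular x) (trans (Σ-const I δ) (cong (ℕ._* δ) |I|))

    ΣJ≡ : ΣJ ≡ suc k ℕ.* δ
    ΣJ≡ = ℕₚ.+-cancelˡ-≡ (suc k ℕ.* δ) ΣJ (suc k ℕ.* δ) (begin
      suc k ℕ.* δ ℕ.+ ΣJ          ≡⟨ cong (ℕ._+ ΣJ) ΣI≡ ⟨
      ΣI ℕ.+ ΣJ                   ≡⟨ 2e≡ΣI+ΣJ ⟨
      edgeCount G ℕ.+ edgeCount G ≡⟨ cong₂ ℕ._+_ e≡ e≡ ⟩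
      suc k ℕ.* δ ℕ.+ suc k ℕ.* δ ∎)
      where open ≡-Reasoning

    |J| : length J ≡ suc k
    |J| = ℕₚ.*-cancelʳ-≡ (length J) (suc k) δ
      (trans (sym (trans (Σ-cong J λ {x} _ → regular x) (Σ-const J δ))) ΣJ≡)

    ΣJJ≡0 : ΣJJ ≡ 0
    ΣJJ≡0 = ℕₚ.+-cancelˡ-≡ ΣI ΣJJ 0 (trans (sym ΣJ≡ΣI+ΣJJ) (trans ΣJ≡ (trans (sym ΣI≡) (sym (ℕₚ.+-identityʳ ΣI)))))

    inner-J : ∀ {y} → y ∈ J → 0 ≡ Σ J (adj y)
    inner-J = Σ-tight (λ _ → z≤n) (ℕₚ.≤-trans (ℕₚ.≤-reflexive ΣJJ≡0) z≤n)

    degree-∈J : ∀ {y} → y ∈ J → Σ I (adj y) ≡ δ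
    degree-∈J {y} y∈J = begin
      Σ I (adj y)                 ≡⟨ ℕₚ.+-identityʳ _ ⟨
      Σ I (adj y) ℕ.+ 0           ≡⟨ cong (Σ I (adj y) ℕ.+_) (inner-J y∈J) ⟩
      Σ I (adj y) ℕ.+ Σ J (adj y) ≡⟨ degree-split y ⟨
      degree G y                  ≡⟨ regular y ⟩
      δ                           ∎
      where open ≡-Reasoning

    J! : Unique J
    J! = unique-++ʳ I (Unique-resp-↭ V↭I++J (Uniqueₚ.allFin⁺ n))
      where
      unique-++ʳ : ∀ xs {ys : List (Fin n)} → Unique (xs ++ ys) → Unique ys
      unique-++ʳ []       u       = u
      unique-++ʳ (_ ∷ xs) (_ ∷ u) = unique-++ʳ xs u

    conclude : ∃[ ps ] map proj₁ ps ≡ I × map proj₂ ps ↭ J × AllPairs Linked-pairs ps → Hamiltonian G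
    conclude (ps , refl , eq₂ , linked) = linkedPairs⇒Hamiltonian
      (subst (3 ℕ.≤_) (sym (trans (sym (Listₚ.length-map proj₁ ps)) |I|)) (s≤s 2≤k)) linked
      (↭-trans V↭I++J (++⁺ˡ (map proj₁ ps) (↭-sym eq₂))) 3≤n

    finish : Dec (δ ℕ.< suc k) → Hamiltonian G
    -- Here δ ≥ K = |J|, so every vertex of I is adjacent to all of J and any pairing will do.
    finish (no δ≮1+k) with ps , refl , refl ← pairUp I J (trans |I| (sym |J|)) =
      conclude (ps , refl , ↭-refl , AllPairs-universal ps λ p∈ q∈ →
        complete (∈-map⁺ proj₁ p∈) (∈-map⁺ proj₂ q∈) , complete (∈-map⁺ proj₁ q∈) (∈-map⁺ proj₂ p∈))
      where
      complete : ∀ {x y} → x ∈ map proj₁ ps → y ∈ map proj₂ ps → x ~ y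
      complete {x} x∈I = all-counted (x ~?_)
        (subst₂ ℕ._≤_ (sym |J|) (trans (sym (regular x)) (degree-∈I x∈I)) (ℕₚ.≮⇒≥ δ≮1+k))
    -- Here δ = k, one less than the size of each part, so every vertex misses exactly one vertex
    -- opposite.
    finish (yes δ<1+k) = conclude (matchNonadjacent I J I! J! (trans |I| (sym |J|))
      (λ {x} x∈I → all-but-one-counted (x ~?_)
        (trans |J| (cong suc (trans k≡δ (trans (sym (regular x)) (degree-∈I x∈I))))))
      λ {x} {x′} x∈I x′∈I y∈J x≁y x′≁y →
        -- Counting from the side of `y`: its single non-neighbour `z` in I must be both `x` and
        -- `x′`.
        let z , _ , _ , other = all-but-one-counted (_ ~?_) (trans |I| (cong suc (trans k≡δ (sym (degree-∈J y∈J)))))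
            is-z : ∀ {w} → w ∈ I → ¬ w ~ _ → w ≡ z
            is-z {w} w∈I w≁y = decidable-stable (w Finₚ.≟ z) λ w≢z → w≁y (~-sym (other w∈I w≢z))
        in trans (is-z x∈I x≁y) (sym (is-z x′∈I x′≁y)))
      where
      k≡δ : k ≡ δ
      k≡δ = ℕₚ.≤-antisym k≤δ (ℕₚ.≤-pred δ<1+k)

-- Clearing denominators

toℚᵘ-ι : ∀ a → ℚ.toℚᵘ (ι a) ℚᵘ.≃ ℚᵘ.mkℚᵘ (ℤ.+ a) 0
toℚᵘ-ι a = ℚₚ.toℚᵘ-fromℚᵘ (ℚᵘ.mkℚᵘ (ℤ.+ a) 0)

ι-+ : ∀ a b → ι (a ℕ.+ b) ≡ ι a + ι b
ι-+ a b = ℚₚ.toℚᵘ-injective (begin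
  ℚ.toℚᵘ (ι (a ℕ.+ b))                              ≈⟨ toℚᵘ-ι (a ℕ.+ b) ⟩
  ℚᵘ.mkℚᵘ (ℤ.+ (a ℕ.+ b)) 0                         ≈⟨ ℚᵘ.*≡* (cong (ℤ._* ℤ.+ 1) (sym (cong₂ ℤ._+_ (ℤₚ.*-identityʳ (ℤ.+ a)) (ℤₚ.*-identityʳ (ℤ.+ b))))) ⟩
  ℚᵘ.mkℚᵘ (ℤ.+ a) 0 ℚᵘ.+ ℚᵘ.mkℚᵘ (ℤ.+ b) 0          ≈⟨ ℚᵘₚ.+-cong (toℚᵘ-ι a) (toℚᵘ-ι b) ⟨
  ℚ.toℚᵘ (ι a) ℚᵘ.+ ℚ.toℚᵘ (ι b)                    ≈⟨ ℚₚ.toℚᵘ-homo-+ (ι a) (ι b) ⟨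
  ℚ.toℚᵘ (ι a + ι b)                                ∎)
  where open ℚᵘₚ.≃-Reasoning

ι-* : ∀ a b → ι (a ℕ.* b) ≡ ι a * ι b
ι-* a b = ℚₚ.toℚᵘ-injective (begin
  ℚ.toℚᵘ (ι (a ℕ.* b))                              ≈⟨ toℚᵘ-ι (a ℕ.* b) ⟩
  ℚᵘ.mkℚᵘ (ℤ.+ (a ℕ.* b)) 0                         ≈⟨ ℚᵘ.*≡* (cong (ℤ._* ℤ.+ 1) (ℤₚ.pos-* a b)) ⟩
  ℚᵘ.mkℚᵘ (ℤ.+ a) 0 ℚᵘ.* ℚᵘ.mkℚᵘ (ℤ.+ b) 0          ≈⟨ ℚᵘₚ.*-cong (toℚᵘ-ι a) (toℚᵘ-ι b) ⟨
  ℚ.toℚᵘ (ι a) ℚᵘ.* ℚ.toℚᵘ (ι b)                    ≈⟨ ℚₚ.toℚᵘ-homo-* (ι a) (ι b) ⟨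
  ℚ.toℚᵘ (ι a * ι b)                                ∎)
  where open ℚᵘₚ.≃-Reasoning

ι-mono-≤ : ∀ {a b} → a ℕ.≤ b → ι a ≤ ι b
ι-mono-≤ {a} {b} a≤b = ℚₚ.toℚᵘ-cancel-≤ (begin
  ℚ.toℚᵘ (ι a)      ≃⟨ toℚᵘ-ι a ⟩
  ℚᵘ.mkℚᵘ (ℤ.+ a) 0 ≤⟨ ℚᵘ.*≤* (ℤₚ.*-monoʳ-≤-nonNeg (ℤ.+ 1) (ℤ.+≤+ a≤b)) ⟩
  ℚᵘ.mkℚᵘ (ℤ.+ b) 0 ≃⟨ toℚᵘ-ι b ⟨
  ℚ.toℚᵘ (ι b)      ∎)
  where open ℚᵘₚ.≤-Reasoning

ι-cancel-≤ : ∀ {a b} → ι a ≤ ι b → a ℕ.≤ b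
ι-cancel-≤ {a} {b} ιa≤ιb = ℤₚ.drop‿+≤+ (ℤₚ.*-cancelʳ-≤-pos (ℤ.+ a) (ℤ.+ b) (ℤ.+ 1) (ℚᵘₚ.drop-*≤* (begin
  ℚᵘ.mkℚᵘ (ℤ.+ a) 0 ≃⟨ toℚᵘ-ι a ⟨
  ℚ.toℚᵘ (ι a)      ≤⟨ ℚₚ.toℚᵘ-mono-≤ ιa≤ιb ⟩
  ℚ.toℚᵘ (ι b)      ≃⟨ toℚᵘ-ι b ⟩
  ℚᵘ.mkℚᵘ (ℤ.+ b) 0 ∎)))
  where open ℚᵘₚ.≤-Reasoning

ι-nonNegative : ∀ a → ℚ.NonNegative (ι a)
ι-nonNegative a = ℚ.nonNegative (ι-mono-≤ {0} {a} z≤n)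

ι-positive : ∀ a .{{_ : ℕ.NonZero a}} → ℚ.Positive (ι a)
ι-positive a = ℚₚ.normalize-pos a 1

infix  4 _↦_
infixr 7 _⊗_
infixr 6 _⊕_

-- A wrapper, since a cannot be inferred from ι a.
record _↦_ (a : ℕ) (x : ℚ) : Set where
  constructor ⌜_⌝
  field cast : ι a ≡ x

` : ∀ a → a ↦ ι a
` a = ⌜ refl ⌝

_⊕_ : ∀ {a b x y} → a ↦ x → b ↦ y → a ℕ.+ b ↦ x + y
_⊕_ {a} {b} ⌜ refl ⌝ ⌜ refl ⌝ = ⌜ ι-+ a b ⌝

_⊗_ : ∀ {a b x y} → a ↦ x → b ↦ y → a ℕ.* b ↦ x * y
_⊗_ {a} {b} ⌜ refl ⌝ ⌜ refl ⌝ = ⌜ ι-* a b ⌝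

cast-≤ : ∀ {a b x y} → a ↦ x → b ↦ y → x ≤ y → a ℕ.≤ b
cast-≤ ⌜ refl ⌝ ⌜ refl ⌝ = ι-cancel-≤

÷₀-cancel : ∀ p q .{{_ : ℚ.Positive q}} → (p ÷₀ q) * q ≡ p
÷₀-cancel p q with q ℚₚ.≟ 0ℚ
... | yes refl = ⊥-elim-irr (ℚₚ.<-irrefl refl (ℚₚ.positive⁻¹ q))
  where
  ⊥-elim-irr : ∀ {w} {W : Set w} → .⊥ → W
  ⊥-elim-irr ()
... | no q≢0 = trans (ℚₚ.*-assoc p _ q)
  (trans (cong (p *_) (ℚₚ.*-inverseˡ q {{ℚ.≢-nonZero q≢0}})) (ℚₚ.*-identityʳ p))

÷₀-nonNegative : ∀ p q .{{_ : ℚ.NonNegative p}} .{{_ : ℚ.Positive q}} → 0ℚ ≤ p ÷₀ q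
÷₀-nonNegative p q = ℚₚ.*-cancelʳ-≤-pos q (begin
  0ℚ * q       ≡⟨ ℚₚ.*-zeroˡ q ⟩
  0ℚ           ≤⟨ ℚₚ.nonNegative⁻¹ p ⟩
  p            ≡⟨ ÷₀-cancel p q ⟨
  (p ÷₀ q) * q ∎)
  where open ℚₚ.≤-Reasoning


e²÷m≤mΔ² : ∀ m {Δ e} → e ℕ.≤ m ℕ.* Δ → ι e ^ 2 ÷₀ ι m ≤ ι m * (ι Δ * ι Δ)
-- Division by zero has the default value 0 here, which equals the right-hand side.
e²÷m≤mΔ² zero {Δ} _ = ℚₚ.≤-reflexive (sym (ℚₚ.*-zeroˡ (ι Δ * ι Δ)))
e²÷m≤mΔ² m@(suc _) {Δ} {e} e≤mΔ = ℚₚ.*-cancelʳ-≤-pos (ι m) {{ι-positive m}} (begin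
  ι e ^ 2 ÷₀ ι m * ι m      ≡⟨ ÷₀-cancel (ι e ^ 2) (ι m) {{ι-positive m}} ⟩
  ι e ^ 2                   ≡⟨ cong (ι e *_) (ℚₚ.*-identityʳ (ι e)) ⟩
  ι e * ι e                 ≡⟨ ι-* e e ⟨
  ι (e ℕ.* e)               ≤⟨ ι-mono-≤ (ℕₚ.*-mono-≤ e≤mΔ e≤mΔ) ⟩
  ι (m ℕ.* Δ ℕ.* (m ℕ.* Δ)) ≡⟨ _↦_.cast ((` m ⊗ ` Δ) ⊗ (` m ⊗ ` Δ)) ⟩
  ι m * ι Δ * (ι m * ι Δ)   ≡⟨ rearrange (ι m) (ι Δ) ⟩
  ι m * (ι Δ * ι Δ) * ι m   ∎)
  where
  open ℚₚ.≤-Reasoning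
  rearrange : ∀ m Δ → m * Δ * (m * Δ) ≡ m * (Δ * Δ) * m
  rearrange = solve 2 (λ m Δ → m :* Δ :* (m :* Δ) := m :* (Δ :* Δ) :* m) refl

module ClearDenominators {m K δ Δ e : ℕ} .{{_ : ℕ.NonZero K}} .{{_ : ℕ.NonZero δ}} .{{_ : ℕ.NonZero Δ}} where

  private instance
    K⁺ : ℚ.Positive (ι K)
    K⁺ = ι-positive K
    δ⁺ : ℚ.Positive (ι δ)
    δ⁺ = ι-positive δ
    Δ⁺ : ℚ.Positive (ι Δ)
    Δ⁺ = ι-positive Δ
    2K⁺ : ℚ.Positive (ι 2 * ι K)
    2K⁺ = ℚₚ.pos*pos⇒pos (ι 2) (ι K)
    2δ⁺ : ℚ.Positive (ι 2 * ι δ)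
    2δ⁺ = ℚₚ.pos*pos⇒pos (ι 2) (ι δ)
    2Kδ⁰ : ℚ.NonNegative (ι 2 * ι K * ι δ)
    2Kδ⁰ = ℚₚ.pos⇒nonNeg (ι 2 * ι K * ι δ) {{ℚₚ.pos*pos⇒pos (ι 2 * ι K) (ι δ)}}
    KΔ³⁺ : ℚ.Positive (ι K * ι Δ ^ 3)
    KΔ³⁺ = ℚₚ.pos*pos⇒pos (ι K) (ι Δ ^ 3) {{ℚₚ.pos*pos⇒pos (ι Δ) (ι Δ ^ 2) {{ℚₚ.pos*pos⇒pos (ι Δ) (ι Δ ^ 1) {{ℚₚ.pos*pos⇒pos (ι Δ) 1ℚ}}}}}}
    KΔ²⁰ : ℚ.NonNegative (ι K * (ι Δ * ι Δ))
    KΔ²⁰ = ℚₚ.pos⇒nonNeg (ι K * (ι Δ * ι Δ)) {{ℚₚ.pos*pos⇒pos (ι K) (ι Δ * ι Δ) {{ℚₚ.pos*pos⇒pos (ι Δ) (ι Δ)}}}}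

  -- `Q` is the difference in the second and fourth conditions, `bracket` the longer expression in
  -- the third and fifth.
  Q bracket : ℚ
  Q       = ι 2 * ι K ^ 2 * ι δ ^ 2 - ι e ^ 2
  bracket = ι 2 * ι K * (ι K * ι δ ^ 2 + ι e ^ 2 ÷₀ ι m) - ι e ^ 2 - ι 2 * ι K * ι m * ι Δ ^ 2

  -- The factor 2Kδ clears both denominators 2K and 2δ at once.
  clear-Z₁ : ∀ {Z} → ι m * ι Δ ^ 2 + ι e ^ 2 ÷₀ (ι 2 * ι K) + (ι K * ι Δ ^ 3) ÷₀ (ι 2 * ι δ) ≤ ι Z →
             2 ℕ.* K ℕ.* δ ℕ.* (m ℕ.* (Δ ℕ.* Δ)) ℕ.+ (δ ℕ.* (e ℕ.* e) ℕ.+ K ℕ.* Δ ℕ.* (K ℕ.* Δ) ℕ.* Δ) ℕ.≤ 2 ℕ.* K ℕ.* δ ℕ.* Z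
  clear-Z₁ {Z} h = cast-≤
    (((` 2 ⊗ ` K) ⊗ ` δ) ⊗ (` m ⊗ (` Δ ⊗ ` Δ)) ⊕ (` δ ⊗ (` e ⊗ ` e) ⊕ ((` K ⊗ ` Δ) ⊗ (` K ⊗ ` Δ)) ⊗ ` Δ))
    (((` 2 ⊗ ` K) ⊗ ` δ) ⊗ ` Z)
    (begin
      2Kδ * (ι m * (ι Δ * ι Δ)) + (ι δ * (ι e * ι e) + ι K * ι Δ * (ι K * ι Δ) * ι Δ)
        ≡⟨ expand (ι m) (ι Δ) (ι e) (ι K) (ι δ) 2Kδ ⟩
      2Kδ * (ι m * ι Δ ^ 2) + (ι δ * ι e ^ 2 + ι K * (ι K * ι Δ ^ 3))
        ≡⟨ cong₂ (λ x y → 2Kδ * (ι m * ι Δ ^ 2) + (ι δ * x + ι K * y))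
             (÷₀-cancel (ι e ^ 2) (ι 2 * ι K)) (÷₀-cancel (ι K * ι Δ ^ 3) (ι 2 * ι δ)) ⟨
      2Kδ * (ι m * ι Δ ^ 2) + (ι δ * (ι e ^ 2 ÷₀ (ι 2 * ι K) * (ι 2 * ι K)) + ι K * ((ι K * ι Δ ^ 3) ÷₀ (ι 2 * ι δ) * (ι 2 * ι δ)))
        ≡⟨ collect (ι m * ι Δ ^ 2) (ι e ^ 2 ÷₀ (ι 2 * ι K)) ((ι K * ι Δ ^ 3) ÷₀ (ι 2 * ι δ)) (ι 2) (ι K) (ι δ) ⟩
      2Kδ * (ι m * ι Δ ^ 2 + ι e ^ 2 ÷₀ (ι 2 * ι K) + (ι K * ι Δ ^ 3) ÷₀ (ι 2 * ι δ))
        ≤⟨ ℚₚ.*-monoˡ-≤-nonNeg 2Kδ h ⟩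
      2Kδ * ι Z ∎)
    where
    open ℚₚ.≤-Reasoning
    2Kδ : ℚ
    2Kδ = ι 2 * ι K * ι δ

    expand : ∀ m Δ e K δ t → t * (m * (Δ * Δ)) + (δ * (e * e) + K * Δ * (K * Δ) * Δ) ≡ t * (m * Δ ^ 2) + (δ * e ^ 2 + K * (K * Δ ^ 3))
    expand = solve 6 (λ m Δ e K δ t → t :* (m :* (Δ :* Δ)) :+ (δ :* (e :* e) :+ K :* Δ :* (K :* Δ) :* Δ)
      := t :* (m :* (Δ :* (Δ :* con 1ℚ))) :+ (δ :* (e :* (e :* con 1ℚ)) :+ K :* (K :* (Δ :* (Δ :* (Δ :* con 1ℚ)))))) refl

    collect : ∀ x a b c K δ → c * K * δ * x + (δ * (a * (c * K)) + K * (b * (c * δ))) ≡ c * K * δ * (x + a + b)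
    collect = solve 6 (λ x a b c K δ → c :* K :* δ :* x :+ (δ :* (a :* (c :* K)) :+ K :* (b :* (c :* δ)))
      := c :* K :* δ :* (x :+ a :+ b)) refl

  -- `X` stands for the last term of either condition on F. After multiplication by K the negative
  -- e² moves to the left, so the result can be stated in ℕ.
  clear-F : ∀ {F X} → ι F ≤ ι m * ι δ ^ 3 + X → X * ι K ≤ ι δ * Q →
            K ℕ.* F ℕ.+ δ ℕ.* (e ℕ.* e) ℕ.≤ K ℕ.* (m ℕ.* (δ ℕ.* δ ℕ.* δ)) ℕ.+ 2 ℕ.* (K ℕ.* K) ℕ.* (δ ℕ.* δ ℕ.* δ)
  clear-F {F} {X} h X≤ = cast-≤
    ((` K ⊗ ` F) ⊕ (` δ ⊗ (` e ⊗ ` e)))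
    ((` K ⊗ (` m ⊗ ((` δ ⊗ ` δ) ⊗ ` δ))) ⊕ ((` 2 ⊗ (` K ⊗ ` K)) ⊗ ((` δ ⊗ ` δ) ⊗ ` δ)))
    (begin
      ι K * ι F + ι δ * (ι e * ι e)
        ≤⟨ ℚₚ.+-monoˡ-≤ _ (ℚₚ.*-monoˡ-≤-nonNeg (ι K) {{ι-nonNegative K}} h) ⟩
      ι K * (ι m * ι δ ^ 3 + X) + ι δ * (ι e * ι e)
        ≡⟨ split (ι K) (ι m * ι δ ^ 3) X (ι δ * (ι e * ι e)) ⟩
      ι K * (ι m * ι δ ^ 3) + ι δ * (ι e * ι e) + X * ι K
        ≤⟨ ℚₚ.+-monoʳ-≤ (ι K * (ι m * ι δ ^ 3) + ι δ * (ι e * ι e)) X≤ ⟩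
      ι K * (ι m * ι δ ^ 3) + ι δ * (ι e * ι e) + ι δ * Q
        ≡⟨ expand (ι m) (ι K) (ι δ) (ι e) (ι 2) ⟩
      ι K * (ι m * (ι δ * ι δ * ι δ)) + ι 2 * (ι K * ι K) * (ι δ * ι δ * ι δ) ∎)
    where
    open ℚₚ.≤-Reasoning
    split : ∀ K a x b → K * (a + x) + b ≡ K * a + b + x * K
    split = solve 4 (λ K a x b → K :* (a :+ x) :+ b := K :* a :+ b :+ x :* K) refl

    expand : ∀ m K δ e c → K * (m * δ ^ 3) + δ * (e * e) + δ * (c * K ^ 2 * δ ^ 2 - e ^ 2) ≡ K * (m * (δ * δ * δ)) + c * (K * K) * (δ * δ * δ)
    expand = solve 5 (λ m K δ e c →
      K :* (m :* (δ :* (δ :* (δ :* con 1ℚ)))) :+ δ :* (e :* e) :+ δ :* (c :* (K :* (K :* con 1ℚ)) :* (δ :* (δ :* con 1ℚ)) :- e :* (e :* con 1ℚ))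
      := K :* (m :* (δ :* δ :* δ)) :+ c :* (K :* K) :* (δ :* δ :* δ)) refl

  -- The multiplier is KΔ³: one factor Δ turns the inverse degree into a bound on n, and KΔ² is left
  -- over. `Y` stands for the last term of either condition on Inv.
  clear-Inv : ∀ {n I Y} → ι n ≤ I * ι Δ → I ≤ ι m ÷₀ ι Δ + Y → Y * (ι K * ι Δ ^ 3) ≤ Q →
              n ℕ.* (K ℕ.* (Δ ℕ.* Δ)) ℕ.+ e ℕ.* e ℕ.≤ m ℕ.* (K ℕ.* (Δ ℕ.* Δ)) ℕ.+ 2 ℕ.* (K ℕ.* K) ℕ.* (δ ℕ.* δ)
  clear-Inv {n} {I} {Y} n≤ h Y≤ = cast-≤
    ((` n ⊗ (` K ⊗ (` Δ ⊗ ` Δ))) ⊕ (` e ⊗ ` e))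
    ((` m ⊗ (` K ⊗ (` Δ ⊗ ` Δ))) ⊕ ((` 2 ⊗ (` K ⊗ ` K)) ⊗ (` δ ⊗ ` δ)))
    (begin
      ι n * (ι K * (ι Δ * ι Δ)) + ι e * ι e
        ≤⟨ ℚₚ.+-monoˡ-≤ (ι e * ι e) (ℚₚ.*-monoʳ-≤-nonNeg (ι K * (ι Δ * ι Δ)) (ℚₚ.≤-trans n≤ (ℚₚ.*-monoʳ-≤-nonNeg (ι Δ) {{ι-nonNegative Δ}} h))) ⟩
      (ι m ÷₀ ι Δ + Y) * ι Δ * (ι K * (ι Δ * ι Δ)) + ι e * ι e
        ≡⟨ split (ι m ÷₀ ι Δ) Y (ι Δ) (ι K) (ι e) ⟩
      (ι m ÷₀ ι Δ) * ι Δ * (ι K * (ι Δ * ι Δ)) + ι e * ι e + Y * (ι K * ι Δ ^ 3)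
        ≡⟨ cong (λ x → x * (ι K * (ι Δ * ι Δ)) + ι e * ι e + Y * (ι K * ι Δ ^ 3)) (÷₀-cancel (ι m) (ι Δ)) ⟩
      ι m * (ι K * (ι Δ * ι Δ)) + ι e * ι e + Y * (ι K * ι Δ ^ 3)
        ≤⟨ ℚₚ.+-monoʳ-≤ (ι m * (ι K * (ι Δ * ι Δ)) + ι e * ι e) Y≤ ⟩
      ι m * (ι K * (ι Δ * ι Δ)) + ι e * ι e + Q
        ≡⟨ expand (ι m * (ι K * (ι Δ * ι Δ))) (ι K) (ι δ) (ι e) (ι 2) ⟩
      ι m * (ι K * (ι Δ * ι Δ)) + ι 2 * (ι K * ι K) * (ι δ * ι δ) ∎)
    where
    open ℚₚ.≤-Reasoning
    split : ∀ a y Δ K e → (a + y) * Δ * (K * (Δ * Δ)) + e * e ≡ a * Δ * (K * (Δ * Δ)) + e * e + y * (K * Δ ^ 3)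
    split = solve 5 (λ a y Δ K e → (a :+ y) :* Δ :* (K :* (Δ :* Δ)) :+ e :* e
      := a :* Δ :* (K :* (Δ :* Δ)) :+ e :* e :+ y :* (K :* (Δ :* (Δ :* (Δ :* con 1ℚ))))) refl

    expand : ∀ x K δ e c → x + e * e + (c * K ^ 2 * δ ^ 2 - e ^ 2) ≡ x + c * (K * K) * (δ * δ)
    expand = solve 5 (λ x K δ e c → x :+ e :* e :+ (c :* (K :* (K :* con 1ℚ)) :* (δ :* (δ :* con 1ℚ)) :- e :* (e :* con 1ℚ))
      := x :+ c :* (K :* K) :* (δ :* δ)) refl

  -- The two differ by 2K(e²/m - mΔ²), which is not positive.
  bracket≤Q : e ℕ.≤ m ℕ.* Δ → bracket ≤ Q
  bracket≤Q e≤mΔ = begin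
    bracket
      ≡⟨ split (ι e ^ 2 ÷₀ ι m) (ι m) (ι K) (ι δ) (ι Δ) (ι e) (ι 2) ⟩
    Q - ι 2 * ι K * (ι m * (ι Δ * ι Δ)) + ι 2 * ι K * (ι e ^ 2 ÷₀ ι m)
      ≤⟨ ℚₚ.+-monoʳ-≤ (Q - ι 2 * ι K * (ι m * (ι Δ * ι Δ)))
           (ℚₚ.*-monoˡ-≤-nonNeg (ι 2 * ι K) {{ℚₚ.pos⇒nonNeg (ι 2 * ι K)}} (e²÷m≤mΔ² m e≤mΔ)) ⟩
    Q - ι 2 * ι K * (ι m * (ι Δ * ι Δ)) + ι 2 * ι K * (ι m * (ι Δ * ι Δ))
      ≡⟨ cancel Q (ι 2 * ι K * (ι m * (ι Δ * ι Δ))) ⟩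
    Q ∎
    where
    open ℚₚ.≤-Reasoning
    split : ∀ x m K δ Δ e c → c * K * (K * δ ^ 2 + x) - e ^ 2 - c * K * m * Δ ^ 2 ≡ c * K ^ 2 * δ ^ 2 - e ^ 2 - c * K * (m * (Δ * Δ)) + c * K * x
    split = solve 7 (λ x m K δ Δ e c →
      c :* K :* (K :* (δ :* (δ :* con 1ℚ)) :+ x) :- e :* (e :* con 1ℚ) :- c :* K :* m :* (Δ :* (Δ :* con 1ℚ))
      := c :* (K :* (K :* con 1ℚ)) :* (δ :* (δ :* con 1ℚ)) :- e :* (e :* con 1ℚ) :- c :* K :* (m :* (Δ :* Δ)) :+ c :* K :* x) refl

    cancel : ∀ q x → q - x + x ≡ q
    cancel = solve 2 (λ q x → q :- x :+ x := q) refl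

  F-term₂ : (ι δ * Q) ÷₀ ι K * ι K ≤ ι δ * Q
  F-term₂ = ℚₚ.≤-reflexive (÷₀-cancel (ι δ * Q) (ι K))

  F-term₃ : e ℕ.≤ m ℕ.* Δ → (ι δ ÷₀ ι K) * bracket * ι K ≤ ι δ * Q
  F-term₃ e≤mΔ = begin
    (ι δ ÷₀ ι K) * bracket * ι K   ≡⟨ swap (ι δ ÷₀ ι K) bracket (ι K) ⟩
    (ι δ ÷₀ ι K) * ι K * bracket   ≡⟨ cong (_* bracket) (÷₀-cancel (ι δ) (ι K)) ⟩
    ι δ * bracket                  ≤⟨ ℚₚ.*-monoˡ-≤-nonNeg (ι δ) {{ι-nonNegative δ}} (bracket≤Q e≤mΔ) ⟩
    ι δ * Q                        ∎
    where
    open ℚₚ.≤-Reasoning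
    swap : ∀ x y z → x * y * z ≡ x * z * y
    swap = solve 3 (λ x y z → x :* y :* z := x :* z :* y) refl

  Inv-term₄ : Q ÷₀ (ι K * ι Δ ^ 3) * (ι K * ι Δ ^ 3) ≤ Q
  Inv-term₄ = ℚₚ.≤-reflexive (÷₀-cancel Q (ι K * ι Δ ^ 3))

  Inv-term₅ : e ℕ.≤ m ℕ.* Δ → (1ℚ ÷₀ (ι K * ι Δ ^ 3)) * bracket * (ι K * ι Δ ^ 3) ≤ Q
  Inv-term₅ e≤mΔ = begin
    (1ℚ ÷₀ KΔ³) * bracket * KΔ³   ≡⟨ swap (1ℚ ÷₀ KΔ³) bracket KΔ³ ⟩
    (1ℚ ÷₀ KΔ³) * KΔ³ * bracket   ≡⟨ cong (_* bracket) (÷₀-cancel 1ℚ KΔ³) ⟩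
    1ℚ * bracket                  ≡⟨ ℚₚ.*-identityˡ bracket ⟩
    bracket                       ≤⟨ bracket≤Q e≤mΔ ⟩
    Q                             ∎
    where
    open ℚₚ.≤-Reasoning
    KΔ³ : ℚ
    KΔ³ = ι K * ι Δ ^ 3
    swap : ∀ x y z → x * y * z ≡ x * z * y
    swap = solve 3 (λ x y z → x :* y :* z := x :* z :* y) refl

-- The five conditions

m+n≤m⇒n≡0 : ∀ m {n} → m ℕ.+ n ℕ.≤ m → n ≡ 0
m+n≤m⇒n≡0 m {n} m+n≤m = ℕₚ.n≤0⇒n≡0 (ℕₚ.+-cancelˡ-≤ m n 0 (subst (m ℕ.+ n ℕ.≤_) (sym (ℕₚ.+-identityʳ m)) m+n≤m))

m*m*n≡0⇒m≡0 : ∀ m n .{{_ : ℕ.NonZero n}} → m ℕ.* m ℕ.* n ≡ 0 → m ≡ 0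
m*m*n≡0⇒m≡0 m n eq = [ id , id ]′ (ℕₚ.m*n≡0⇒m≡0∨n≡0 m (ℕₚ.m*n≡0⇒m≡0 (m ℕ.* m) n eq))

-- With P = s + t, Δ = δ + r and e = s + w, the two sides differ by
-- δt² + P²r + δ(w² + 2sw).
squeeze-Z₁ : ∀ {δ Δ P s e} .{{_ : ℕ.NonZero δ}} .{{_ : ℕ.NonZero P}} → δ ℕ.≤ Δ → s ℕ.≤ P → s ℕ.≤ e →
             δ ℕ.* (e ℕ.* e) ℕ.+ P ℕ.* P ℕ.* Δ ℕ.≤ 2 ℕ.* δ ℕ.* P ℕ.* s → Δ ≡ δ × e ≡ P
squeeze-Z₁ {δ} {s = s} δ≤Δ s≤P s≤e h
  with r , refl ← ℕₚ.m≤n⇒∃[o]m+o≡n δ≤Δ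
  with t , refl ← ℕₚ.m≤n⇒∃[o]m+o≡n s≤P
  with w , refl ← ℕₚ.m≤n⇒∃[o]m+o≡n s≤e =
  let rest≡0 = m+n≤m⇒n≡0 (2 ℕ.* δ ℕ.* (s ℕ.+ t) ℕ.* s) (ℕₚ.≤-trans (ℕₚ.≤-reflexive (sym (expand δ s t r w))) h)
      t≡0    = m*m*n≡0⇒m≡0 t δ (ℕₚ.m+n≡0⇒m≡0 (t ℕ.* t ℕ.* δ) rest≡0)
      rest′  = ℕₚ.m+n≡0⇒n≡0 (t ℕ.* t ℕ.* δ) rest≡0
      rP²    = ℕₚ.m+n≡0⇒m≡0 (r ℕ.* (s ℕ.+ t) ℕ.* (s ℕ.+ t)) rest′
      r≡0    = ℕₚ.m*n≡0⇒m≡0 r (s ℕ.+ t) (ℕₚ.m*n≡0⇒m≡0 (r ℕ.* (s ℕ.+ t)) (s ℕ.+ t) rP²)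
      w≡0    = m*m*n≡0⇒m≡0 w δ (ℕₚ.m+n≡0⇒m≡0 (w ℕ.* w ℕ.* δ) (ℕₚ.m+n≡0⇒n≡0 (r ℕ.* (s ℕ.+ t) ℕ.* (s ℕ.+ t)) rest′))
  in trans (cong (δ ℕ.+_) r≡0) (ℕₚ.+-identityʳ δ) , cong (s ℕ.+_) (trans w≡0 (sym t≡0))
  where
  expand : ∀ δ s t r w → δ ℕ.* ((s ℕ.+ w) ℕ.* (s ℕ.+ w)) ℕ.+ (s ℕ.+ t) ℕ.* (s ℕ.+ t) ℕ.* (δ ℕ.+ r) ≡
    2 ℕ.* δ ℕ.* (s ℕ.+ t) ℕ.* s ℕ.+ (t ℕ.* t ℕ.* δ ℕ.+ (r ℕ.* (s ℕ.+ t) ℕ.* (s ℕ.+ t) ℕ.+ (w ℕ.* w ℕ.* δ ℕ.+ 2 ℕ.* s ℕ.* w ℕ.* δ)))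
  expand = solve-∀

-- With F = (K + m)δ³ + f and e = Kδ + w, the two sides differ by Kf + δw² + 2Kδ²w.
squeeze-F : ∀ {K m δ F e} .{{_ : ℕ.NonZero K}} .{{_ : ℕ.NonZero δ}} →
  (K ℕ.+ m) ℕ.* (δ ℕ.* δ ℕ.* δ) ℕ.≤ F → K ℕ.* δ ℕ.≤ e →
  K ℕ.* F ℕ.+ δ ℕ.* (e ℕ.* e) ℕ.≤ K ℕ.* (m ℕ.* (δ ℕ.* δ ℕ.* δ)) ℕ.+ 2 ℕ.* (K ℕ.* K) ℕ.* (δ ℕ.* δ ℕ.* δ) →
  F ≡ (K ℕ.+ m) ℕ.* (δ ℕ.* δ ℕ.* δ) × e ≡ K ℕ.* δ
squeeze-F {K} {m} {δ} F≥ e≥ h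
  with f , refl ← ℕₚ.m≤n⇒∃[o]m+o≡n F≥
  with w , refl ← ℕₚ.m≤n⇒∃[o]m+o≡n e≥ =
  let rest≡0 = m+n≤m⇒n≡0 (K ℕ.* (m ℕ.* (δ ℕ.* δ ℕ.* δ)) ℕ.+ 2 ℕ.* (K ℕ.* K) ℕ.* (δ ℕ.* δ ℕ.* δ)) (ℕₚ.≤-trans (ℕₚ.≤-reflexive (sym (expand K m δ f w))) h)
      f≡0    = ℕₚ.m*n≡0⇒m≡0 f K (ℕₚ.m+n≡0⇒m≡0 (f ℕ.* K) rest≡0)
      w≡0    = m*m*n≡0⇒m≡0 w δ (ℕₚ.m+n≡0⇒m≡0 (w ℕ.* w ℕ.* δ) (ℕₚ.m+n≡0⇒n≡0 (f ℕ.* K) rest≡0))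
  in trans (cong (_ ℕ.+_) f≡0) (ℕₚ.+-identityʳ _) , trans (cong (K ℕ.* δ ℕ.+_) w≡0) (ℕₚ.+-identityʳ _)
  where
  expand : ∀ K m δ f w → K ℕ.* ((K ℕ.+ m) ℕ.* (δ ℕ.* δ ℕ.* δ) ℕ.+ f) ℕ.+ δ ℕ.* ((K ℕ.* δ ℕ.+ w) ℕ.* (K ℕ.* δ ℕ.+ w)) ≡
    K ℕ.* (m ℕ.* (δ ℕ.* δ ℕ.* δ)) ℕ.+ 2 ℕ.* (K ℕ.* K) ℕ.* (δ ℕ.* δ ℕ.* δ) ℕ.+ (f ℕ.* K ℕ.+ (w ℕ.* w ℕ.* δ ℕ.+ 2 ℕ.* K ℕ.* δ ℕ.* δ ℕ.* w))
  expand = solve-∀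

-- With Δ = δ + r and e = Kδ + w, the two sides differ by K²r² + w² + 2K²δr + 2Kδw.
squeeze-Inv : ∀ {K m δ Δ e} .{{_ : ℕ.NonZero K}} → δ ℕ.≤ Δ → K ℕ.* δ ℕ.≤ e →
  (K ℕ.+ m) ℕ.* (K ℕ.* (Δ ℕ.* Δ)) ℕ.+ e ℕ.* e ℕ.≤ m ℕ.* (K ℕ.* (Δ ℕ.* Δ)) ℕ.+ 2 ℕ.* (K ℕ.* K) ℕ.* (δ ℕ.* δ) →
  Δ ≡ δ × e ≡ K ℕ.* δ
squeeze-Inv {K} {m} {δ} δ≤Δ e≥ h
  with r , refl ← ℕₚ.m≤n⇒∃[o]m+o≡n δ≤Δ
  with w , refl ← ℕₚ.m≤n⇒∃[o]m+o≡n e≥ =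
  let rest≡0 = m+n≤m⇒n≡0 (m ℕ.* (K ℕ.* ((δ ℕ.+ r) ℕ.* (δ ℕ.+ r))) ℕ.+ 2 ℕ.* (K ℕ.* K) ℕ.* (δ ℕ.* δ)) (ℕₚ.≤-trans (ℕₚ.≤-reflexive (sym (expand K m δ r w))) h)
      r≡0    = m*m*n≡0⇒m≡0 r (K ℕ.* K) {{ℕₚ.m*n≢0 K K}} (ℕₚ.m+n≡0⇒m≡0 (r ℕ.* r ℕ.* (K ℕ.* K)) rest≡0)
      w≡0    = m*m*n≡0⇒m≡0 w 1 (ℕₚ.m+n≡0⇒m≡0 (w ℕ.* w ℕ.* 1) (ℕₚ.m+n≡0⇒n≡0 (r ℕ.* r ℕ.* (K ℕ.* K)) rest≡0))
  in trans (cong (δ ℕ.+_) r≡0) (ℕₚ.+-identityʳ δ) , trans (cong (K ℕ.* δ ℕ.+_) w≡0) (ℕₚ.+-identityʳ _)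
  where
  expand : ∀ K m δ r w → (K ℕ.+ m) ℕ.* (K ℕ.* ((δ ℕ.+ r) ℕ.* (δ ℕ.+ r))) ℕ.+ (K ℕ.* δ ℕ.+ w) ℕ.* (K ℕ.* δ ℕ.+ w) ≡
    m ℕ.* (K ℕ.* ((δ ℕ.+ r) ℕ.* (δ ℕ.+ r))) ℕ.+ 2 ℕ.* (K ℕ.* K) ℕ.* (δ ℕ.* δ) ℕ.+
    (r ℕ.* r ℕ.* (K ℕ.* K) ℕ.+ (w ℕ.* w ℕ.* 1 ℕ.+ (2 ℕ.* K ℕ.* K ℕ.* δ ℕ.* r ℕ.+ 2 ℕ.* K ℕ.* δ ℕ.* w)))
  expand = solve-∀

-- Each term satisfies Δ/d ≥ 1; positivity of d keeps `÷₀` away from its default value.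
length≤Δ*Σ1/d : ∀ {A : Set} (d : A → ℕ) {Δ} → (∀ x → ℕ.NonZero (d x)) → (∀ x → d x ℕ.≤ Δ) → ∀ xs →
                ι (length xs) ≤ List.foldr _+_ 0ℚ (map (λ x → 1ℚ ÷₀ ι (d x)) xs) * ι Δ
length≤Δ*Σ1/d d {Δ} d≢0 d≤Δ []       = ℚₚ.≤-reflexive (sym (ℚₚ.*-zeroˡ (ι Δ)))
length≤Δ*Σ1/d d {Δ} d≢0 d≤Δ (x ∷ xs) = begin
  ι (suc (length xs))                                 ≡⟨ ι-+ 1 (length xs) ⟩
  1ℚ + ι (length xs)                                    ≤⟨ ℚₚ.+-mono-≤ 1≤ (length≤Δ*Σ1/d d d≢0 d≤Δ xs) ⟩
  (1ℚ ÷₀ ι (d x)) * ι Δ + S * ι Δ                       ≡⟨ ℚₚ.*-distribʳ-+ (ι Δ) (1ℚ ÷₀ ι (d x)) S ⟨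
  (1ℚ ÷₀ ι (d x) + S) * ι Δ                             ∎
  where
  open ℚₚ.≤-Reasoning
  S : ℚ
  S = List.foldr _+_ 0ℚ (map (λ x → 1ℚ ÷₀ ι (d x)) xs)

  instance
    d⁺ : ℚ.Positive (ι (d x))
    d⁺ = ι-positive (d x) {{d≢0 x}}

  1≤ : 1ℚ ≤ (1ℚ ÷₀ ι (d x)) * ι Δ
  1≤ = begin
    1ℚ                        ≡⟨ ÷₀-cancel 1ℚ (ι (d x)) ⟨
    (1ℚ ÷₀ ι (d x)) * ι (d x) ≤⟨ ℚₚ.*-monoˡ-≤-nonNeg (1ℚ ÷₀ ι (d x)) {{ℚ.nonNegative (÷₀-nonNegative 1ℚ (ι (d x)))}} (ι-mono-≤ (d≤Δ x)) ⟩
    (1ℚ ÷₀ ι (d x)) * ι Δ     ∎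

-- Each condition forces regularity and e = Kδ

module Extremal {n : ℕ} (G : Graph n) {k δ Δ : ℕ} (δ≤ : ∀ u → δ ℕ.≤ degree G u) (≤Δ : ∀ u → degree G u ℕ.≤ Δ)
                {{δ≢0 : ℕ.NonZero δ}} {{Δ≢0 : ℕ.NonZero Δ}} (δ≤Δ : δ ℕ.≤ Δ)
                {I J : List (Fin n)} (|I| : length I ≡ suc k) (ind : LongestCycle.Independent G I) (V↭I++J : allFin n ↭ I ++ J) where
  open Bipartite G
  open Split ind V↭I++J

  K m e : ℕ
  K = suc k
  m = length J
  e = edgeCount G

  open ClearDenominators {m} {K} {δ} {Δ} {e}

  n≡K+m : n ≡ K ℕ.+ m
  n≡K+m = trans n≡|I|+|J| (cong (ℕ._+ m) |I|)

  Kδ≤ΣI : K ℕ.* δ ℕ.≤ ΣI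
  Kδ≤ΣI = subst (ℕ._≤ ΣI) (trans (Σ-const I δ) (cong (ℕ._* δ) |I|)) (Σ-mono {xs = I} λ {u} _ → δ≤ u)

  Kδ≤e : K ℕ.* δ ℕ.≤ e
  Kδ≤e = ℕₚ.≤-trans Kδ≤ΣI ΣI≤e

  ΣI≤KΔ : ΣI ℕ.≤ K ℕ.* Δ
  ΣI≤KΔ = subst (ΣI ℕ.≤_) (trans (Σ-const I Δ) (cong (ℕ._* Δ) |I|)) (Σ-mono {xs = I} λ {u} _ → ≤Δ u)

  e≤mΔ : e ℕ.≤ m ℕ.* Δ
  e≤mΔ = ℕₚ.≤-trans e≤ΣJ (subst (ΣJ ℕ.≤_) (Σ-const J Δ) (Σ-mono {xs = J} λ {u} _ → ≤Δ u))

  -- Only one factor of each square over I is replaced by Δ: the surviving `ΣI` can be compared with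
  -- both e and KΔ.
  Z₁≤ : Z₁ G ℕ.≤ Δ ℕ.* ΣI ℕ.+ m ℕ.* (Δ ℕ.* Δ)
  Z₁≤ = begin
    Z₁ G                                                      ≡⟨ Σ-split (λ u → degree G u ℕ.^ 2) ⟩
    Σ I (λ u → degree G u ℕ.^ 2) ℕ.+ Σ J (λ u → degree G u ℕ.^ 2)
      ≤⟨ ℕₚ.+-mono-≤ (Σ-mono {xs = I} λ {u} _ → ℕₚ.*-mono-≤ (≤Δ u) (ℕₚ.≤-reflexive (ℕₚ.*-identityʳ (degree G u))))
                     (Σ-mono {xs = J} λ {u} _ → ℕₚ.*-mono-≤ (≤Δ u) (subst (ℕ._≤ Δ) (sym (ℕₚ.*-identityʳ (degree G u))) (≤Δ u))) ⟩
    Σ I (λ u → Δ ℕ.* degree G u) ℕ.+ Σ J (λ _ → Δ ℕ.* Δ)     ≡⟨ cong₂ ℕ._+_ (Σ-*ˡ I Δ (degree G)) (Σ-const J (Δ ℕ.* Δ)) ⟩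
    Δ ℕ.* ΣI ℕ.+ m ℕ.* (Δ ℕ.* Δ)                              ∎
    where open ℕₚ.≤-Reasoning

  Σδ³ : Σ (allFin n) (λ _ → δ ℕ.^ 3) ≡ (K ℕ.+ m) ℕ.* (δ ℕ.* δ ℕ.* δ)
  Σδ³ = trans (Σ-const (allFin n) (δ ℕ.^ 3)) (cong₂ ℕ._*_ (trans (length-allFin n) n≡K+m) (cube δ))
    where
    cube : ∀ δ → δ ℕ.^ 3 ≡ δ ℕ.* δ ℕ.* δ
    cube δ = trans (cong (λ x → δ ℕ.* (δ ℕ.* x)) (ℕₚ.*-identityʳ δ)) (sym (ℕₚ.*-assoc δ δ δ))

  δ³≤ : ∀ {u} → u ∈ allFin n → δ ℕ.^ 3 ℕ.≤ degree G u ℕ.^ 3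
  δ³≤ {u} _ = ℕₚ.^-monoˡ-≤ 3 (δ≤ u)

  Tight : Set
  Tight = (∀ u → degree G u ≡ δ) × e ≡ K ℕ.* δ

  Δ≡δ⇒Tight : Δ ≡ δ × e ≡ K ℕ.* δ → Tight
  Δ≡δ⇒Tight (Δ≡δ , e≡) = (λ u → ℕₚ.≤-antisym (subst (degree G u ℕ.≤_) Δ≡δ (≤Δ u)) (δ≤ u)) , e≡

  Z₁-tight : 2 ℕ.* K ℕ.* δ ℕ.* (m ℕ.* (Δ ℕ.* Δ)) ℕ.+ (δ ℕ.* (e ℕ.* e) ℕ.+ K ℕ.* Δ ℕ.* (K ℕ.* Δ) ℕ.* Δ) ℕ.≤ 2 ℕ.* K ℕ.* δ ℕ.* Z₁ G → Tight
  Z₁-tight h =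
    -- Applied with P = KΔ and s = `ΣI`, once the common term 2KδmΔ² is cancelled.
    let Δ≡δ , e≡KΔ = squeeze-Z₁ {{δ≢0}} {{ℕₚ.m*n≢0 K Δ}} δ≤Δ ΣI≤KΔ ΣI≤e
                       (ℕₚ.+-cancelˡ-≤ (2 ℕ.* K ℕ.* δ ℕ.* (m ℕ.* (Δ ℕ.* Δ))) _ _ (begin
          2 ℕ.* K ℕ.* δ ℕ.* (m ℕ.* (Δ ℕ.* Δ)) ℕ.+ (δ ℕ.* (e ℕ.* e) ℕ.+ K ℕ.* Δ ℕ.* (K ℕ.* Δ) ℕ.* Δ)
            ≤⟨ h ⟩
          2 ℕ.* K ℕ.* δ ℕ.* Z₁ G
            ≤⟨ ℕₚ.*-monoʳ-≤ (2 ℕ.* K ℕ.* δ) Z₁≤ ⟩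
          2 ℕ.* K ℕ.* δ ℕ.* (Δ ℕ.* ΣI ℕ.+ m ℕ.* (Δ ℕ.* Δ))
            ≡⟨ regroup K δ Δ ΣI (m ℕ.* (Δ ℕ.* Δ)) ⟩
          2 ℕ.* K ℕ.* δ ℕ.* (m ℕ.* (Δ ℕ.* Δ)) ℕ.+ 2 ℕ.* δ ℕ.* (K ℕ.* Δ) ℕ.* ΣI ∎))
    in Δ≡δ⇒Tight (Δ≡δ , trans e≡KΔ (cong (K ℕ.*_) Δ≡δ))
    where
    open ℕₚ.≤-Reasoning
    regroup : ∀ K δ Δ s x → 2 ℕ.* K ℕ.* δ ℕ.* (Δ ℕ.* s ℕ.+ x) ≡ 2 ℕ.* K ℕ.* δ ℕ.* x ℕ.+ 2 ℕ.* δ ℕ.* (K ℕ.* Δ) ℕ.* s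
    regroup = solve-∀

  F-tight : K ℕ.* F G ℕ.+ δ ℕ.* (e ℕ.* e) ℕ.≤ K ℕ.* (m ℕ.* (δ ℕ.* δ ℕ.* δ)) ℕ.+ 2 ℕ.* (K ℕ.* K) ℕ.* (δ ℕ.* δ ℕ.* δ) → Tight
  F-tight h =
    let F≡ , e≡ = squeeze-F {K} {m} {δ} (subst (ℕ._≤ F G) Σδ³ (Σ-mono δ³≤)) Kδ≤e h
    -- F attains its lower bound nδ³, so every cube equals δ³, and a degree above δ would have a
    -- strictly larger cube.
    in (λ u → ℕₚ.≤-antisym
         (ℕₚ.≮⇒≥ λ δ<d → ℕₚ.<⇒≢ (ℕₚ.^-monoˡ-< 3 δ<d)
           (Σ-tight δ³≤ (ℕₚ.≤-reflexive (trans F≡ (sym Σδ³))) (∈-allFin u)))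
         (δ≤ u))
     , e≡

  Inv-tight : n ℕ.* (K ℕ.* (Δ ℕ.* Δ)) ℕ.+ e ℕ.* e ℕ.≤ m ℕ.* (K ℕ.* (Δ ℕ.* Δ)) ℕ.+ 2 ℕ.* (K ℕ.* K) ℕ.* (δ ℕ.* δ) → Tight
  Inv-tight h = Δ≡δ⇒Tight (squeeze-Inv {K} {m} δ≤Δ Kδ≤e
    (subst (λ n → n ℕ.* (K ℕ.* (Δ ℕ.* Δ)) ℕ.+ e ℕ.* e ℕ.≤ m ℕ.* (K ℕ.* (Δ ℕ.* Δ)) ℕ.+ 2 ℕ.* (K ℕ.* K) ℕ.* (δ ℕ.* δ)) n≡K+m h))

  n≤Inv*Δ : ι n ≤ Inv G * ι Δ
  n≤Inv*Δ = subst (λ l → ι l ≤ Inv G * ι Δ) (length-allFin n)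
    (length≤Δ*Σ1/d (degree G) (λ u → ℕ.>-nonZero (ℕₚ.<-≤-trans (ℕ.>-nonZero⁻¹ δ) (δ≤ u))) ≤Δ (allFin n))

  K≡ : ι k + 1ℚ ≡ ι K
  K≡ = trans (ℚₚ.+-comm (ι k) 1ℚ) (sym (ι-+ 1 k))

  m≡ : ι n - ι k - 1ℚ ≡ ι m
  m≡ = trans (cong (λ x → x - ι k - 1ℚ) (trans (cong ι n≡K+m) (trans (ι-+ K m) (cong (_+ ι m) (ι-+ 1 k)))))
             (solve 3 (λ k m o → o :+ k :+ m :- k :- o := m) refl (ι k) (ι m) 1ℚ)

  -- `M` and `κ` abstract the rational expressions n - k - 1 and k + 1, so that matching on `refl`
  -- replaces all their occurrences by `ι m` and `ι K`.
  tight : ∀ {M κ} → M ≡ ι m → κ ≡ ι K →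
      ( ι (Z₁ G) ≥ M * ι Δ ^ 2 + ι e ^ 2 ÷₀ (ι 2 * κ) + (κ * ι Δ ^ 3) ÷₀ (ι 2 * ι δ)
      ⊎ ι (F G) ≤ M * ι δ ^ 3 + (ι δ * (ι 2 * κ ^ 2 * ι δ ^ 2 - ι e ^ 2)) ÷₀ κ
      ⊎ ι (F G) ≤ M * ι δ ^ 3 + (ι δ ÷₀ κ) * (ι 2 * κ * (κ * ι δ ^ 2 + ι e ^ 2 ÷₀ M) - ι e ^ 2 - ι 2 * κ * M * ι Δ ^ 2)
      ⊎ Inv G ≤ M ÷₀ ι Δ + (ι 2 * κ ^ 2 * ι δ ^ 2 - ι e ^ 2) ÷₀ (κ * ι Δ ^ 3)
      ⊎ Inv G ≤ M ÷₀ ι Δ + (1ℚ ÷₀ (κ * ι Δ ^ 3)) * (ι 2 * κ * (κ * ι δ ^ 2 + ι e ^ 2 ÷₀ M) - ι e ^ 2 - ι 2 * κ * M * ι Δ ^ 2)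
      ) → Tight
  tight refl refl (inj₁ h)                      = Z₁-tight (clear-Z₁ {Z₁ G} h)
  tight refl refl (inj₂ (inj₁ h))               = F-tight (clear-F {F G} h F-term₂)
  tight refl refl (inj₂ (inj₂ (inj₁ h)))        = F-tight (clear-F {F G} h (F-term₃ e≤mΔ))
  tight refl refl (inj₂ (inj₂ (inj₂ (inj₁ h)))) = Inv-tight (clear-Inv {n} n≤Inv*Δ h Inv-term₄)
  tight refl refl (inj₂ (inj₂ (inj₂ (inj₂ h)))) = Inv-tight (clear-Inv {n} n≤Inv*Δ h (Inv-term₅ e≤mΔ))

theorem2 : ∀ (n k : ℕ) (G : Graph n) (δ Δ : ℕ) → k ℕ.≥ 2 → n ℕ.≥ 3 → IsConnected[_] G k → IsMinDegree G δ → IsMaxDegree G Δ →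
  let n′ = ι n
      k′ = ι k
      e  = ι (edgeCount G)
      δ′ = ι δ
      Δ′ = ι Δ
  in
    ( ι (Z₁ G) ≥ (n′ - k′ - 1ℚ) * Δ′ ^ 2 + e ^ 2 ÷₀ (ι 2 * (k′ + 1ℚ)) + ((k′ + 1ℚ) * Δ′ ^ 3) ÷₀ (ι 2 * δ′)
    ⊎ ι (F G) ≤ (n′ - k′ - 1ℚ) * δ′ ^ 3 + (δ′ * (ι 2 * (k′ + 1ℚ) ^ 2 * δ′ ^ 2 - e ^ 2)) ÷₀ (k′ + 1ℚ)
    ⊎ ι (F G) ≤ (n′ - k′ - 1ℚ) * δ′ ^ 3 + (δ′ ÷₀ (k′ + 1ℚ)) * (ι 2 * (k′ + 1ℚ) * ((k′ + 1ℚ) * δ′ ^ 2 + e ^ 2 ÷₀ (n′ - k′ - 1ℚ)) - e ^ 2 - ι 2 * (k′ + 1ℚ) * (n′ - k′ - 1ℚ) * Δ′ ^ 2)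
    ⊎ Inv G ≤ (n′ - k′ - 1ℚ) ÷₀ Δ′ + (ι 2 * (k′ + 1ℚ) ^ 2 * δ′ ^ 2 - e ^ 2) ÷₀ ((k′ + 1ℚ) * Δ′ ^ 3)
    ⊎ Inv G ≤ (n′ - k′ - 1ℚ) ÷₀ Δ′ + (1ℚ ÷₀ ((k′ + 1ℚ) * Δ′ ^ 3)) * (ι 2 * (k′ + 1ℚ) * ((k′ + 1ℚ) * δ′ ^ 2 + e ^ 2 ÷₀ (n′ - k′ - 1ℚ)) - e ^ 2 - ι 2 * (k′ + 1ℚ) * (n′ - k′ - 1ℚ) * Δ′ ^ 2)
    ) → Hamiltonian G
theorem2 n k G δ Δ 2≤k 3≤n conn ((u , du≡δ) , δ≤) (_ , ≤Δ) condition =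
  [ id , fromIndependent ]′ (LongestCycle.chvátal-erdős G 2≤k 3≤n conn)
  where
  k≤δ : k ℕ.≤ δ
  k≤δ = subst (k ℕ.≤_) du≡δ (LongestCycle.k≤degree G conn u)

  δ≤Δ : δ ℕ.≤ Δ
  δ≤Δ = ℕₚ.≤-trans (δ≤ u) (≤Δ u)

  instance
    δ≢0 : ℕ.NonZero δ
    δ≢0 = ℕ.>-nonZero (ℕₚ.≤-trans (ℕ.s≤s ℕ.z≤n) (ℕₚ.≤-trans 2≤k k≤δ))
    Δ≢0 : ℕ.NonZero Δ
    Δ≢0 = ℕ.>-nonZero (ℕₚ.<-≤-trans (ℕ.>-nonZero⁻¹ δ) δ≤Δ)

  fromIndependent : LongestCycle.IndependentSet G (suc k) → Hamiltonian G
  fromIndependent (I , |I| , I! , ind) =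
    let J , V↭I++J   = Unique-complement {ys = allFin n} I! (λ _ → ∈-allFin _)
        open Extremal G {k} {δ} {Δ} δ≤ ≤Δ δ≤Δ |I| ind V↭I++J
        regular , e≡ = tight m≡ K≡ condition
    in Bipartite.extremal⇒Hamiltonian G 2≤k 3≤n k≤δ |I| I! ind regular e≡
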